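{- For every positive integer $r$ there exists $\varepsilon=\varepsilon(r)>0$ such that the following holds. If $G$ is a finite graph not containing $K_r$ as a topological minor, $X,Y\subseteq V(G)$, $k$ is a positive integer and there are $k$ pairwise vertex-disjoint $X$-$Y$-paths in $G$, then there exists a family of at least $\varepsilon k+\frac12$ pairwise non-adjacent $X$-$Y$-paths in $G$.
   Context: A graph $H$ is a topological minor of $G$ if $G$ contains as a subgraph a subdivision of $H$ (a graph obtained from $H$ by replacing its edges by internally disjoint paths of positive length). An $X$-$Y$-path is a path with one endpoint in $X$ and the other endpoint in $Y$; a single vertex of $X\cap Y$ counts as an $X$-$Y$-path. Paths are pairwise non-adjacent if they are pairwise vertex-disjoint and no edge of $G$ joins vertices of two different ones. -}

module Defs where

open import Data.Nat using (ℕ; _<_)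
open import Data.Fin using (Fin)
open import Data.Fin.Subset using (Subset; _∈_)
open import Data.List using (List; []; _∷_; head; last)
open import Data.List.Relation.Unary.Unique.Propositional using (Unique)
import Data.List.Membership.Propositional as LM
open import Data.Maybe using (just)
open import Data.Product using (_×_; Σ)
open import Data.Empty using (⊥)
open import Relation.Nullary using (¬_)
open import Relation.Binary.PropositionalEquality using (_≡_; _≢_)
open import Relation.Binary.Definitions using (Decidable)
open import Function.Definitions using (Injective)
open import Data.Sum using (_⊎_)

record Graph (n : ℕ) : Set₁ where
  field
    Adj    : Fin n → Fin n → Set
    adj?   : Decidable Adj
    sym    : ∀ {u v} → Adj u v → Adj v u
    irrefl : ∀ {u} → ¬ Adj u u
open Graph public

data IsWalk {n : ℕ} (G : Graph n) : List (Fin n) → Set where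
  single : ∀ v → IsWalk G (v ∷ [])
  step   : ∀ u v vs → Adj G u v → IsWalk G (v ∷ vs) → IsWalk G (u ∷ v ∷ vs)

IsPath : {n : ℕ} → Graph n → List (Fin n) → Set
IsPath G p = IsWalk G p × Unique p

IsPathFromTo : {n : ℕ} → Graph n → Fin n → Fin n → List (Fin n) → Set
IsPathFromTo G a b p = IsPath G p × head p ≡ just a × last p ≡ just b

-- An X-Y-path: a path with one endpoint in X and the other in Y.
-- (Paths are unoriented; the list is oriented so that its first vertex is in X.)
IsXYPath : {n : ℕ} → Graph n → Subset n → Subset n → List (Fin n) → Set
IsXYPath G X Y p = Σ (Fin _) λ a → Σ (Fin _) λ b →
  a ∈ X × b ∈ Y × IsPathFromTo G a b p

DisjointXYPaths : {n : ℕ} → Graph n → Subset n → Subset n → (m : ℕ) → (Fin m → List (Fin n)) → Set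
DisjointXYPaths G X Y m P =
  (∀ i → IsXYPath G X Y (P i)) ×
  (∀ i j → i ≢ j → ∀ v → v LM.∈ P i → v LM.∈ P j → ⊥)

NonAdjacentXYPaths : {n : ℕ} → Graph n → Subset n → Subset n → (m : ℕ) → (Fin m → List (Fin n)) → Set
NonAdjacentXYPaths G X Y m P =
  DisjointXYPaths G X Y m P ×
  (∀ i j → i ≢ j → ∀ u v → u LM.∈ P i → v LM.∈ P j → ¬ Adj G u v)

-- G contains a subdivision of K_r as a subgraph:
-- injective branch vertices b, and for each pair i < j a path Q i j from b i to b j
-- in G, such that every vertex of Q i j other than its ends b i, b j is not a
-- branch vertex and lies on no other path Q k l (k < l, (k,l) ≠ (i,j)).
-- (Positive length is automatic since b is injective.)
HasTopMinorK : {n : ℕ} → (r : ℕ) → Graph n → Set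
HasTopMinorK {n} r G =
  Σ (Fin r → Fin n) λ b →
  Σ ((i j : Fin r) → List (Fin n)) λ Q →
    Injective _≡_ _≡_ b ×
    (∀ i j → Data.Fin._<_ i j → IsPathFromTo G (b i) (b j) (Q i j)) ×
    (∀ i j → Data.Fin._<_ i j → ∀ v → v LM.∈ Q i j →
       v ≡ b i ⊎ v ≡ b j ⊎
       ((∀ t → v ≢ b t) ×
        (∀ k l → Data.Fin._<_ k l → ¬ (k ≡ i × l ≡ j) → ¬ (v LM.∈ Q k l))))
  where import Data.Fin

{-# OPTIONS --safe #-}

-- Contract each of the k given paths to a vertex. If the resulting graph has a large
-- independent set, we are done; otherwise (Duchet–Meyniel) it has a large clique minor,
-- whose branch sets are unions of the given paths. Call a vertex free if no small set S
-- separates it from a given path avoiding S. Any r free vertices can be linked through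
-- the clique minor to a subdivision of K_r, so fewer than r vertices are free. If a small
-- set S leaves given paths in two different components, recurse into both sides: the
-- additive ½ pays for the paths that S meets. Otherwise every vertex v that is not free
-- lies in a region that a small set S v cuts off and that meets only given paths meeting
-- S v. Contracting these regions gives a quotient of bounded degree, and by Menger's
-- theorem only a constant fraction of the disjoint paths is lost in it. In bounded degree Δ,
-- take a colouring in which vertices of equal colour have disjoint closed neighbourhoods,
-- and for one colour after the other contract the closed neighbourhoods of its vertices:
-- each time Menger's theorem gives at least k / (Δ + 1) disjoint paths, and after
-- shortening them to induced paths the vertices of that colour have neighbours only on
-- their own path, which remains true in all later rounds.
module Submission where

open import Defs
open import Data.Nat using (ℕ; zero; suc; pred; _≤_; _<_; z≤n; s≤s; >-nonZero)
import Data.Nat.Properties as ℕ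
open import Data.Nat.Tactic.RingSolver using (solve-∀)
open import Data.Fin using (Fin; zero; suc; punchOut; inject≤; remQuot; combine; splitAt; join; fromℕ<) renaming (_<_ to _<ᶠ_)
import Data.Fin.Properties as F
open import Data.Fin.Subset using (Subset)
open import Data.Fin.Subset.Properties using () renaming (_∈?_ to _∈ₛ?_)
open import Data.Bool using (Bool; true; false)
import Data.Integer.Base as ℤ
import Data.Integer.Properties as ℤ
import Data.Rational.Properties as ℚ
open import Data.Rational.Unnormalised using (mkℚᵘ)
import Data.Rational.Unnormalised.Base as ℚᵘ
import Data.Rational.Unnormalised.Properties as ℚᵘ
open import Data.List using (List; []; _∷_; _++_; length; lookup; map; filter; cartesianProduct; deduplicate; concatMap; allFin; head; last)
open import Data.List.Properties using (length-++; length-map; length-tabulate; length-filter)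
open import Data.List.Membership.Propositional using (_∈_; _∉_; find)
import Data.List.Membership.Propositional.Properties as M
open import Data.List.Relation.Unary.Any using (Any; here; there; any?; index)
import Data.List.Relation.Unary.Any as Any
open import Data.List.Relation.Unary.All using (All; []; _∷_)
import Data.List.Relation.Unary.All as All
import Data.List.Relation.Unary.AllPairs as AllPairs
open import Data.List.Relation.Unary.Unique.Propositional using (Unique)
open import Data.Maybe using (just)
open import Data.Product using (Σ; ∃; _×_; _,_; proj₁; proj₂)
open import Data.Sum using (_⊎_; inj₁; inj₂; [_,_]′)
import Data.Sum as Sum
open import Data.Sum.Properties using (≡-dec; inj₁-injective; inj₂-injective)
open import Data.Unit using (⊤; tt)
open import Data.Empty using (⊥; ⊥-elim)
open import Function using (_∘_; id; case_of_)
open import Relation.Nullary using (¬_; Dec; yes; no)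
open import Relation.Nullary.Decidable using (map′; _×-dec_; _⊎-dec_; ¬?; decidable-stable)
open import Relation.Unary using () renaming (Decidable to Decidable₁)
open import Relation.Binary.Definitions using (Decidable; Symmetric; DecidableEquality)
open import Relation.Binary.PropositionalEquality using (_≡_; _≢_; refl; trans; cong; cong₂; subst; subst₂)
import Relation.Binary.PropositionalEquality as ≡

-- A clique minor alone yields no subdivision of K_r: each branch vertex needs r - 1 exits of its
-- own, whereas a branch set may consist of vertices of small degree. Freeness is a Menger condition
-- that provides these exits. Absence of a topological minor is not inherited by quotients, so it
-- has to be spent before any region is contracted; afterwards only the degree bound counts, and
-- this bound is the size of the cuts, hence depends on r alone.
--
-- The claim is proved by induction as k + M ≤ 2 M m, which is m ≥ k / (2 M) + ½. Where m is found
-- directly, k ≤ M m is enough, since m ≥ 1 supplies the other half. Where the paths are split, the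
-- two bounds contain M twice although it is due only once.
--
-- Vertices are never deleted from the type: a part of the graph is a predicate together with the
-- edge relation restricted to it. This is why quotients carry a domain on which the fibres have to
-- be connected.

module InducedMenger where
  open import Data.Nat using (_+_; _*_; _^_)
  open import Data.Rational using (ℚ; _/_; ½; 0ℚ; toℚᵘ) renaming (_+_ to _+ℚ_; _*_ to _*ℚ_; _<_ to _<ℚ_; _≤_ to _≤ℚ_)

  -- Walks

  -- A missed `y` could be punched out of the codomain, which leaves an injection into too small a
  -- set. This turns counting into incidence: k disjoint paths that meet a set of at most k elements
  -- occupy all of it.
  injective⇒surjective : ∀ {k l} (f : Fin k → Fin l) → (∀ {i j} → f i ≡ f j → i ≡ j) → l ≤ k →
    ∀ y → ∃ λ x → f x ≡ y
  injective⇒surjective {k} {suc l} f inj l≤k y with F.any? (λ x → f x F.≟ y)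
  ... | yes hit = hit
  ... | no  miss = ⊥-elim (ℕ.<-irrefl refl (ℕ.≤-trans l≤k (F.injective⇒≤ inj′)))
    where
    y≢ : ∀ x → y ≢ f x
    y≢ x eq = miss (x , ≡.sym eq)
    inj′ : ∀ {i j} → punchOut (y≢ i) ≡ punchOut (y≢ j) → i ≡ j
    inj′ {i} {j} eq = inj (F.punchOut-injective (y≢ i) (y≢ j) eq)

  module _ {A : Set} where

    lookup-index : ∀ {x : A} {xs} (x∈xs : x ∈ xs) → lookup xs (index x∈xs) ≡ x
    lookup-index (here refl)  = refl
    lookup-index (there x∈xs) = lookup-index x∈xs

    index-injective : ∀ {x y : A} {xs} (p : x ∈ xs) (q : y ∈ xs) → index p ≡ index q → x ≡ y
    index-injective {xs = xs} p q eq =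
      trans (≡.sym (lookup-index p)) (trans (cong (lookup xs) eq) (lookup-index q))

    lookup∈ : ∀ (xs : List A) i → lookup xs i ∈ xs
    lookup∈ (x ∷ xs) zero    = here refl
    lookup∈ (x ∷ xs) (suc i) = there (lookup∈ xs i)

    lookup-injective : ∀ {xs : List A} → Unique xs → ∀ {i j} → lookup xs i ≡ lookup xs j → i ≡ j
    lookup-injective (_ AllPairs.∷ _)  {zero}  {zero}  eq = refl
    lookup-injective {x ∷ xs} (x∉ AllPairs.∷ _) {zero}  {suc j} eq = ⊥-elim (All.lookup x∉ (lookup∈ xs j) eq)
    lookup-injective {x ∷ xs} (x∉ AllPairs.∷ _) {suc i} {zero}  eq = ⊥-elim (All.lookup x∉ (lookup∈ xs i) (≡.sym eq))
    lookup-injective (_ AllPairs.∷ un) {suc i} {suc j} eq = cong suc (lookup-injective un eq)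

    injective⇒≤length : ∀ {k} {xs : List A} (f : Fin k → A) → (∀ i → f i ∈ xs) →
      (∀ {i j} → f i ≡ f j → i ≡ j) → k ≤ length xs
    injective⇒≤length f f∈ inj =
      F.injective⇒≤ {f = λ i → index (f∈ i)} (λ {i} {j} eq → inj (index-injective (f∈ i) (f∈ j) eq))

    Unique-⊆⇒length≤ : ∀ {xs ys : List A} → Unique xs → (∀ {x} → x ∈ xs → x ∈ ys) → length xs ≤ length ys
    Unique-⊆⇒length≤ {xs} un sub = injective⇒≤length (lookup xs) (sub ∘ lookup∈ xs) (lookup-injective un)

  module _ {V : Set} where

    data Walk (E : V → V → Set) : V → V → List V → Set where
      stop : ∀ {v} → Walk E v v (v ∷ [])
      _◂_  : ∀ {u v w p} → E u v → Walk E v w p → Walk E u w (u ∷ p)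

    infixr 5 _◂_

    private variable
      E E′ : V → V → Set
      a b c d x : V
      p q : List V

    walk-start : Walk E a b p → a ∈ p
    walk-start stop    = here refl
    walk-start (_ ◂ _) = here refl

    walk-end : Walk E a b p → b ∈ p
    walk-end stop    = here refl
    walk-end (_ ◂ w) = there (walk-end w)

    walk-map : (∀ {u v} → u ∈ p → v ∈ p → E u v → E′ u v) → Walk E a b p → Walk E′ a b p
    walk-map f stop    = stop
    walk-map f (e ◂ w) = f (here refl) (there (walk-start w)) e ◂ walk-map (λ u∈ v∈ → f (there u∈) (there v∈)) w

    walk-all : {U : V → Set} → (∀ {u v} → E u v → U v) → U a → Walk E a b p → x ∈ p → U x
    walk-all stays Ua stop    (here refl) = Ua
    walk-all stays Ua (e ◂ w) (here refl) = Ua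
    walk-all stays Ua (e ◂ w) (there x∈)  = walk-all stays (stays e) w x∈

    walk-join : Walk E a b p → E b c → Walk E c d q → Walk E a d (p ++ q)
    walk-join stop    e w′ = e ◂ w′
    walk-join (f ◂ w) e w′ = f ◂ walk-join w e w′

    walk-trans : Walk E a b p → Walk E b c q → ∃ λ r → Walk E a c r × (∀ {x} → x ∈ r → x ∈ p ⊎ x ∈ q)
    walk-trans {p = p} w stop = p , w , inj₁
    walk-trans {p = p} w (_◂_ {p = q} e w′) =
      p ++ q , walk-join w e w′ , λ x∈ → [ inj₁ , inj₂ ∘ there ]′ (M.∈-++⁻ p x∈)

    walk-prefix : Walk E a b p → x ∈ p → ∃ λ q → Walk E a x q × (∀ {y} → y ∈ q → y ∈ p)
    walk-prefix stop    (here refl) = _ , stop , id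
    walk-prefix (e ◂ w) (here refl) = _ , stop , λ { (here refl) → here refl }
    walk-prefix (e ◂ w) (there x∈)  =
      let q , w′ , sub = walk-prefix w x∈
      in  _ , e ◂ w′ , λ { (here refl) → here refl ; (there y∈) → there (sub y∈) }

    walk-suffix : Walk E a b p → x ∈ p → ∃ λ q → Walk E x b q × (∀ {y} → y ∈ q → y ∈ p)
    walk-suffix w       (here refl) with w
    ... | stop   = _ , stop , id
    ... | e ◂ w′ = _ , e ◂ w′ , id
    walk-suffix (e ◂ w) (there x∈)  =
      let q , w′ , sub = walk-suffix w x∈ in q , w′ , there ∘ sub

    walk-reverse : Symmetric E → Walk E a b p → ∃ λ q → Walk E b a q × (∀ {y} → y ∈ q → y ∈ p)
    walk-reverse sy stop = _ , stop , id
    walk-reverse sy (e ◂ w) =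
      let q , w′ , sub = walk-reverse sy w
      in  _ , walk-join w′ (sy e) stop ,
          λ y∈ → [ there ∘ sub , (λ { (here refl) → here refl }) ]′ (M.∈-++⁻ q y∈)

    walk-between : Symmetric E → ∀ {x y} → Walk E a b p → x ∈ p → y ∈ p →
      ∃ λ q → Walk E x y q × (∀ {v} → v ∈ q → v ∈ p)
    walk-between sy w x∈ y∈ =
      let _ , wx , sx = walk-prefix w x∈
          _ , wy , sy′ = walk-prefix w y∈
          _ , wr , sr = walk-reverse sy wx
          q , w′ , s  = walk-trans wr wy
      in  q , w′ , λ v∈ → [ sx ∘ sr , sy′ ]′ (s v∈)

    -- A walk along `Leaving E T` can be in `T` only at its last vertex, a walk along `Entering E T`
    -- only at its first. Hence a walk along `Entering E S` from a vertex outside `S` is a walk that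
    -- avoids `S`.
    Leaving Entering : (V → V → Set) → (V → Set) → V → V → Set
    Leaving  E T u v = E u v × ¬ T u
    Entering E T u v = E u v × ¬ T v

    leaving-end : {T : V → Set} → Walk (Leaving E T) a b p → x ∈ p → T x → x ≡ b
    leaving-end stop          (here refl) Tx = refl
    leaving-end ((_ , ¬T) ◂ w) (here refl) Tx = ⊥-elim (¬T Tx)
    leaving-end (_ ◂ w)       (there x∈)  Tx = leaving-end w x∈ Tx

    entering-start : {T : V → Set} → Walk (Entering E T) a b p → x ∈ p → T x → x ≡ a
    entering-start stop    (here refl) Tx = refl
    entering-start (e ◂ w) (here refl) Tx = refl
    entering-start ((_ , ¬T) ◂ w) (there x∈) Tx with entering-start w x∈ Tx
    ... | refl = ⊥-elim (¬T Tx)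

    first-hit : {T : V → Set} → Decidable₁ T → Walk E a b p → T b →
      ∃ λ c → ∃ λ q → T c × Walk (Leaving E T) a c q × (∀ {y} → y ∈ q → y ∈ p)
    first-hit T? stop Tb = _ , _ , Tb , stop , id
    first-hit {a = a} T? (e ◂ w) Tb with T? a
    ... | yes Ta = _ , _ , Ta , stop , λ { (here refl) → here refl }
    ... | no ¬Ta =
      let c , q , Tc , w′ , sub = first-hit T? w Tb
      in  c , _ , Tc , (e , ¬Ta) ◂ w′ , λ { (here refl) → here refl ; (there y∈) → there (sub y∈) }

    last-hit : {T : V → Set} → Decidable₁ T → Walk E a b p → T a →
      ∃ λ c → ∃ λ q → T c × Walk (Entering E T) c b q × (∀ {y} → y ∈ q → y ∈ p)
    last-hit {E = E} {T = T} T? w Ta with go w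
      where
      go : ∀ {a b p} → Walk E a b p →
        (∃ λ c → ∃ λ q → T c × Walk (Entering E T) c b q × (∀ {y} → y ∈ q → y ∈ p))
        ⊎ (¬ T a × Walk (Entering E T) a b p)
      go {a} stop with T? a
      ... | yes Ta = inj₁ (_ , _ , Ta , stop , id)
      ... | no ¬Ta = inj₂ (¬Ta , stop)
      go {a} (e ◂ w) with go w
      ... | inj₁ (c , q , Tc , w′ , sub) = inj₁ (c , q , Tc , w′ , there ∘ sub)
      ... | inj₂ (¬Tv , w′) with T? a
      ...   | yes Ta = inj₁ (_ , _ , Ta , (e , ¬Tv) ◂ w′ , id)
      ...   | no ¬Ta = inj₂ (¬Ta , (e , ¬Tv) ◂ w′)
    ... | inj₁ hit = hit
    ... | inj₂ (¬Ta , _) = ⊥-elim (¬Ta Ta)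

    record Family (E : V → V → Set) (X Y : V → Set) (k : ℕ) : Set where
      field
        path     : Fin k → List V
        src dst  : Fin k → V
        walk     : ∀ i → Walk E (src i) (dst i) (path i)
        src∈X    : ∀ i → X (src i)
        dst∈Y    : ∀ i → Y (dst i)
    open Family public

    Disjoint : ∀ {X Y k} → Family E X Y k → Set
    Disjoint P = ∀ {i j x} → x ∈ path P i → x ∈ path P j → i ≡ j

    Separates : (E : V → V → Set) (X Y : V → Set) → (V → Set) → Set
    Separates E X Y S = ∀ {a b p} → X a → Y b → Walk E a b p → ∃ λ x → x ∈ p × S x

    family-map : ∀ {X Y X′ Y′ k} → (∀ {u v} → E u v → E′ u v) → (∀ {v} → X v → X′ v) → (∀ {v} → Y v → Y′ v) →
      Family E X Y k → Family E′ X′ Y′ k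
    family-map f g h P = record
      { path  = path P
      ; src   = src P
      ; dst   = dst P
      ; walk  = λ i → walk-map (λ _ _ → f) (walk P i)
      ; src∈X = λ i → g (src∈X P i)
      ; dst∈Y = λ i → h (dst∈Y P i)
      }

  -- Menger's theorem

  record Finite (V : Set) : Set where
    field
      _≟_      : DecidableEquality V
      elements : List V
      complete : ∀ v → v ∈ elements

  module MengerTheorem {V : Set} (fin : Finite V) where
    open Finite fin
    open import Data.List.Membership.DecPropositional _≟_ using (_∈?_)
    open import Data.List.Relation.Unary.Unique.DecPropositional.Properties _≟_ using (deduplicate-!)
    import Data.List.Relation.Unary.Unique.Propositional.Properties as Unique

    Edge : List (V × V) → V → V → Set
    Edge es u v = (u , v) ∈ es

    Outcome : (E : V → V → Set) (X Y : V → Set) → ℕ → Set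
    Outcome E X Y k =
      Σ (Family E X Y k) Disjoint ⊎ ∃ λ S → length S < k × Separates E X Y (_∈ S)

    -- The prefix stops before the first use of the new edge and the suffix begins after the last
    -- use, so both use old edges only.
    avoid-or-use : ∀ {x y es a b p} → Walk (Edge ((x , y) ∷ es)) a b p →
      Walk (Edge es) a b p ⊎
      ((∃ λ q → Walk (Edge es) a x q × (∀ {v} → v ∈ q → v ∈ p)) ×
       (∃ λ q → Walk (Edge es) y b q × (∀ {v} → v ∈ q → v ∈ p)))
    avoid-or-use stop = inj₁ stop
    avoid-or-use (here refl ◂ w) with avoid-or-use w
    ... | inj₁ w′ = inj₂ ((_ , stop , λ { (here refl) → here refl }) , (_ , w′ , there))
    ... | inj₂ (_ , (q , w′ , sub)) = inj₂ ((_ , stop , λ { (here refl) → here refl }) , (q , w′ , there ∘ sub))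
    avoid-or-use (there e ◂ w) with avoid-or-use w
    ... | inj₁ w′ = inj₁ (e ◂ w′)
    ... | inj₂ ((q , w′ , sub) , (q₂ , w₂ , sub₂)) =
      inj₂ ((_ , e ◂ w′ , λ { (here refl) → here refl ; (there v∈) → there (sub v∈) }) , (q₂ , w₂ , there ∘ sub₂))

    -- Walks are single vertices here, so the intersection of `X` and `Y`, listed without
    -- repetition, is a largest family and a smallest separator at once.
    edgeless : ∀ {X Y} → Decidable₁ X → Decidable₁ Y → ∀ k → Outcome (Edge []) X Y k
    edgeless {X} {Y} X? Y? k with k ℕ.≤? length both
      where
      both = filter (λ v → X? v ×-dec Y? v) (deduplicate _≟_ elements)
    ... | yes k≤ = inj₁ (record
        { path  = λ i → lookup both (inject≤ i k≤) ∷ []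
        ; src   = λ i → lookup both (inject≤ i k≤)
        ; dst   = λ i → lookup both (inject≤ i k≤)
        ; walk  = λ i → stop
        ; src∈X = λ i → proj₁ (XY (lookup∈ both (inject≤ i k≤)))
        ; dst∈Y = λ i → proj₂ (XY (lookup∈ both (inject≤ i k≤)))
        } , λ { (here refl) (here eq) → F.inject≤-injective k≤ k≤ _ _ (lookup-injective unique eq) })
      where
      both = filter (λ v → X? v ×-dec Y? v) (deduplicate _≟_ elements)
      unique : Unique both
      unique = Unique.filter⁺ (λ v → X? v ×-dec Y? v) (deduplicate-! elements)
      XY : ∀ {v} → v ∈ both → X v × Y v
      XY v∈ = proj₂ (M.∈-filter⁻ (λ v → X? v ×-dec Y? v) {xs = deduplicate _≟_ elements} v∈)
    ... | no k≰ = inj₂ (both , ℕ.≰⇒> k≰ , λ { Xa Yb stop → _ , here refl , both∋ Xa Yb ; _ _ (() ◂ _) })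
      where
      both = filter (λ v → X? v ×-dec Y? v) (deduplicate _≟_ elements)
      both∋ : ∀ {v} → X v → Y v → v ∈ both
      both∋ {v} Xv Yv = M.∈-filter⁺ (λ v → X? v ×-dec Y? v) (M.∈-deduplicate⁺ _≟_ (complete v)) (Xv , Yv)

    -- Both families are in bijection with the positions of the lists x ∷ S and y ∷ S,
    -- so position 0 is glued along the edge (x , y) and the others at a common vertex.
    module Glue {es : List (V × V)} {x y : V} {S : List V} {k : ℕ} {X Y : V → Set} (|S|<k : length S < k)
      (sep : Separates (Edge es) X Y (_∈ S))
      (P : Family (Leaving (Edge es) (_∈ x ∷ S)) X (_∈ x ∷ S) k) (P-disj : Disjoint P)
      (Q : Family (Entering (Edge es) (_∈ y ∷ S)) (_∈ y ∷ S) Y k) (Q-disj : Disjoint Q) where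

      f g : Fin k → Fin (suc (length S))
      f i = index (dst∈Y P i)
      g j = index (src∈X Q j)

      g-injective : ∀ {i j} → g i ≡ g j → i ≡ j
      g-injective {i} {j} eq = Q-disj (walk-start (walk Q i))
        (subst (_∈ path Q j) (≡.sym (index-injective (src∈X Q i) (src∈X Q j) eq)) (walk-start (walk Q j)))

      f-injective : ∀ {i j} → f i ≡ f j → i ≡ j
      f-injective {i} {j} eq = P-disj (walk-end (walk P i))
        (subst (_∈ path P j) (≡.sym (index-injective (dst∈Y P i) (dst∈Y P j) eq)) (walk-end (walk P j)))

      mate : Fin k → Fin k
      mate i = proj₁ (injective⇒surjective g g-injective |S|<k (f i))

      g-mate : ∀ i → g (mate i) ≡ f i
      g-mate i = proj₂ (injective⇒surjective g g-injective |S|<k (f i))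

      mate-injective : ∀ {i j} → mate i ≡ mate j → i ≡ j
      mate-injective {i} {j} eq = f-injective (trans (≡.sym (g-mate i)) (trans (cong g eq) (g-mate j)))

      es′ = (x , y) ∷ es

      glued : ∀ i → ∃ λ r → Walk (Edge es′) (src P i) (dst Q (mate i)) r ×
        (∀ {v} → v ∈ r → v ∈ path P i ⊎ v ∈ path Q (mate i))
      glued i = go (dst∈Y P i) (src∈X Q (mate i)) (≡.sym (g-mate i))
        (walk-map (λ _ _ e → there (proj₁ e)) (walk P i))
        (walk-map (λ _ _ e → there (proj₁ e)) (walk Q (mate i)))
        where
        go : ∀ {a b c d p q} (m : b ∈ x ∷ S) (m′ : c ∈ y ∷ S) → index m ≡ index m′ →
          Walk (Edge es′) a b p → Walk (Edge es′) c d q →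
          ∃ λ r → Walk (Edge es′) a d r × (∀ {v} → v ∈ r → v ∈ p ⊎ v ∈ q)
        go {p = p} (here refl) (here refl) eq wp wq = _ , walk-join wp (here refl) wq , M.∈-++⁻ p
        go (there m) (there m′) eq wp wq with index-injective m m′ (F.suc-injective eq)
        ... | refl = walk-trans wp wq

      shared-separator : ∀ {i j s} → s ∈ path P i → s ∈ path Q j → s ∈ S → mate i ≡ j
      shared-separator {i} {j} {s} s∈P s∈Q s∈S =
        g-injective (trans (g-mate i) (trans (cong f (≡.sym i′≡i)) (trans f-i′ (trans (≡.sym g-j′) (cong g j′≡j)))))
        where
        atQ = injective⇒surjective g g-injective |S|<k (suc (index s∈S))
        atP = injective⇒surjective f f-injective |S|<k (suc (index s∈S))
        j′ = proj₁ atQ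
        i′ = proj₁ atP
        g-j′ = proj₂ atQ
        f-i′ = proj₂ atP
        j′≡j : j′ ≡ j
        j′≡j = Q-disj (subst (_∈ path Q j′) (index-injective (src∈X Q j′) (there s∈S) g-j′) (walk-start (walk Q j′))) s∈Q
        i′≡i : i′ ≡ i
        i′≡i = P-disj (subst (_∈ path P i′) (index-injective (dst∈Y P i′) (there s∈S) f-i′) (walk-end (walk P i′))) s∈P

      -- A vertex v common to P i and Q j gives an X–Y walk through v, which meets S; but
      -- P i and Q j meet S only in their end and in their start.
      crossing : ∀ {i j v} → v ∈ path P i → v ∈ path Q j → mate i ≡ j
      crossing {i} {j} {v} v∈P v∈Q
        with p₁ , w₁ , _ ← walk-prefix (walk P i) v∈P
           | p₂ , w₂ , _ ← walk-suffix (walk Q j) v∈Q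
        with r , w , split ← walk-trans (walk-map (λ _ _ → proj₁) w₁) (walk-map (λ _ _ → proj₁) w₂)
        with s , s∈r , s∈S ← sep (src∈X P i) (dst∈Y Q j) w
        with split s∈r
      ... | inj₁ s∈p₁ = shared-separator v∈P v∈Q (subst (_∈ S) (leaving-end w₁ s∈p₁ (there s∈S)) s∈S)
      ... | inj₂ s∈p₂ = shared-separator v∈P v∈Q (subst (_∈ S) (entering-start w₂ s∈p₂ (there s∈S)) s∈S)

      result : Σ (Family (Edge es′) X Y k) Disjoint
      result = record
        { path  = λ i → proj₁ (glued i)
        ; src   = src P
        ; dst   = λ i → dst Q (mate i)
        ; walk  = λ i → proj₁ (proj₂ (glued i))
        ; src∈X = src∈X P
        ; dst∈Y = λ i → dst∈Y Q (mate i)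
        } , disjoint
        where
        disjoint : ∀ {i j v} → v ∈ proj₁ (glued i) → v ∈ proj₁ (glued j) → i ≡ j
        disjoint {i} {j} v∈i v∈j with proj₂ (proj₂ (glued i)) v∈i | proj₂ (proj₂ (glued j)) v∈j
        ... | inj₁ a | inj₁ b = P-disj a b
        ... | inj₁ a | inj₂ b = mate-injective (crossing a b)
        ... | inj₂ a | inj₁ b = ≡.sym (mate-injective (crossing b a))
        ... | inj₂ a | inj₂ b = mate-injective (Q-disj a b)

    truncate-end : ∀ {E : V → V → Set} {X T : V → Set} {k} → Decidable₁ T → (P : Family E X T k) → Disjoint P →
      Σ (Family (Leaving E T) X T k) Disjoint
    truncate-end {T = T} T? P disj = record
      { path  = λ i → proj₁ (proj₂ (hit i))
      ; src   = src P
      ; dst   = λ i → proj₁ (hit i)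
      ; walk  = λ i → proj₁ (proj₂ (proj₂ (proj₂ (hit i))))
      ; src∈X = src∈X P
      ; dst∈Y = λ i → proj₁ (proj₂ (proj₂ (hit i)))
      } , λ {i} {j} v∈i v∈j → disj (sub i v∈i) (sub j v∈j)
      where
      hit = λ i → first-hit T? (walk P i) (dst∈Y P i)
      sub : ∀ i {v} → v ∈ proj₁ (proj₂ (hit i)) → v ∈ path P i
      sub i = proj₂ (proj₂ (proj₂ (proj₂ (hit i))))

    truncate-start : ∀ {E : V → V → Set} {T Y : V → Set} {k} → Decidable₁ T → (P : Family E T Y k) → Disjoint P →
      Σ (Family (Entering E T) T Y k) Disjoint
    truncate-start {T = T} T? P disj = record
      { path  = λ i → proj₁ (proj₂ (hit i))
      ; src   = λ i → proj₁ (hit i)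
      ; dst   = dst P
      ; walk  = λ i → proj₁ (proj₂ (proj₂ (proj₂ (hit i))))
      ; src∈X = λ i → proj₁ (proj₂ (proj₂ (hit i)))
      ; dst∈Y = dst∈Y P
      } , λ {i} {j} v∈i v∈j → disj (sub i v∈i) (sub j v∈j)
      where
      hit = λ i → last-hit T? (walk P i) (src∈X P i)
      sub : ∀ i {v} → v ∈ proj₁ (proj₂ (hit i)) → v ∈ path P i
      sub i = proj₂ (proj₂ (proj₂ (proj₂ (hit i))))

    -- Induction on the edges. A walk either avoids the new edge and meets the old separator `S`, or
    -- it has an old prefix ending in `x` and an old suffix starting in `y`. So fewer than k
    -- vertices that separate `X` from `x ∷ S`, or `y ∷ S` from `Y`, already separate `X` from `Y`.
    -- If there are none, k disjoint walks exist on both sides, which forces `S` to have exactly k -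
    -- 1 elements, and the two families fit together.
    menger-edges : ∀ es {X Y} → Decidable₁ X → Decidable₁ Y → ∀ k → Outcome (Edge es) X Y k
    menger-edges [] X? Y? k = edgeless X? Y? k
    menger-edges ((x , y) ∷ es) {X} {Y} X? Y? k with menger-edges es X? Y? k
    ... | inj₁ (P , disj) = inj₁ (family-map there id id P , disj)
    ... | inj₂ (S , |S|<k , sep)
      with menger-edges es X? (_∈? (x ∷ S)) k | menger-edges es (_∈? (y ∷ S)) Y? k
    ... | inj₂ (T , |T|<k , sepT) | _ = inj₂ (T , |T|<k , separates)
      where
      separates : Separates (Edge ((x , y) ∷ es)) X Y (_∈ T)
      separates Xa Yb w with avoid-or-use w
      ... | inj₂ ((q , w′ , sub) , _) =
        let v , v∈q , v∈T = sepT Xa (here refl) w′ in v , sub v∈q , v∈T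
      ... | inj₁ w′ =
        let s , s∈p , s∈S   = sep Xa Yb w′
            q , w″ , sub    = walk-prefix w′ s∈p
            v , v∈q , v∈T   = sepT Xa (there s∈S) w″
        in  v , sub v∈q , v∈T
    ... | inj₁ _ | inj₂ (T , |T|<k , sepT) = inj₂ (T , |T|<k , separates)
      where
      separates : Separates (Edge ((x , y) ∷ es)) X Y (_∈ T)
      separates Xa Yb w with avoid-or-use w
      ... | inj₂ (_ , (q , w′ , sub)) =
        let v , v∈q , v∈T = sepT (here refl) Yb w′ in v , sub v∈q , v∈T
      ... | inj₁ w′ =
        let s , s∈p , s∈S   = sep Xa Yb w′
            q , w″ , sub    = walk-suffix w′ s∈p
            v , v∈q , v∈T   = sepT (there s∈S) Yb w″
        in  v , sub v∈q , v∈T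
    ... | inj₁ (P , P-disj) | inj₁ (Q , Q-disj) =
      let P′ , P′-disj = truncate-end (_∈? (x ∷ S)) P P-disj
          Q′ , Q′-disj = truncate-start (_∈? (y ∷ S)) Q Q-disj
      in  inj₁ (Glue.result |S|<k sep P′ P′-disj Q′ Q′-disj)

    abstract
      menger : ∀ {E : V → V → Set} {X Y : V → Set} → Decidable E → Decidable₁ X → Decidable₁ Y → ∀ k → Outcome E X Y k
      menger {E} {X} {Y} E? X? Y? k with menger-edges edges X? Y? k
        where
        edges : List (V × V)
        edges = filter (λ e → E? (proj₁ e) (proj₂ e)) (cartesianProduct elements elements)
      ... | inj₁ (P , disj) =
        inj₁ (family-map (λ e → proj₂ (M.∈-filter⁻ (λ e → E? (proj₁ e) (proj₂ e)) {xs = cartesianProduct elements elements} e)) id id P , disj)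
      ... | inj₂ (S , |S|<k , sep) = inj₂ (S , |S|<k , λ Xa Yb w → sep Xa Yb
          (walk-map (λ {u} {v} _ _ e → M.∈-filter⁺ (λ e → E? (proj₁ e) (proj₂ e)) (M.∈-cartesianProduct⁺ (complete u) (complete v)) e) w))

      -- Menger's theorem for k = 1: a separator with fewer than one element is empty, and a walk
      -- would have to meet it.
      reachable? : ∀ {E : V → V → Set} → Decidable E → ∀ (a b : V) → Dec (∃ λ p → Walk E a b p)
      reachable? {E} E? a b with menger E? (_≟ a) (_≟ b) 1
      ... | inj₁ (P , _) = yes (path P zero , subst₂ (λ u v → Walk E u v (path P zero)) (src∈X P zero) (dst∈Y P zero) (walk P zero))
      ... | inj₂ ([] , _ , sep) = no λ (p , w) → case sep refl refl w of λ { (_ , _ , ()) }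
      ... | inj₂ (_ ∷ _ , s≤s () , _)

  -- Quotients

  exists? : ∀ {V : Set} → Finite V → {P : V → Set} → Decidable₁ P → Dec (∃ P)
  exists? fin P? = map′ Any.satisfied (λ (v , Pv) → Any.map (λ { refl → Pv }) (complete v)) (any? P? elements)
    where open Finite fin

  -- Loops are left out so that the quotient is irreflexive, as the argument for bounded degree
  -- requires.
  Quotient : {V W : Set} → (V → V → Set) → (V → W) → W → W → Set
  Quotient E φ a b = a ≢ b × ∃ λ u → ∃ λ v → E u v × φ u ≡ a × φ v ≡ b

  LabelDisjoint : {V W : Set} {E : V → V → Set} {X Y : V → Set} {k : ℕ} → (V → W) → Family E X Y k → Set
  LabelDisjoint φ P = ∀ {i j x y} → x ∈ path P i → y ∈ path P j → φ x ≡ φ y → i ≡ j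

  ConnectedFibres : {V W : Set} → (V → V → Set) → (V → Set) → (V → W) → Set
  ConnectedFibres E Dom φ = ∀ {u v} → Dom u → Dom v → φ u ≡ φ v →
    ∃ λ p → Walk E u v p × (∀ {x} → x ∈ p → φ x ≡ φ u)

  module Quotients {V W : Set} (finV : Finite V) (finW : Finite W)
    {E : V → V → Set} (E? : Decidable E) (φ : V → W) where
    private
      module V = Finite finV
      module W = Finite finW
    open MengerTheorem finW using (menger)

    quotient? : Decidable (Quotient E φ)
    quotient? a b = ¬? (a W.≟ b) ×-dec
      exists? finV λ u → exists? finV λ v → E? u v ×-dec (φ u W.≟ a) ×-dec (φ v W.≟ b)

    project : ∀ {u v p} → Walk E u v p →
      ∃ λ q → Walk (Quotient E φ) (φ u) (φ v) q × (∀ {a} → a ∈ q → ∃ λ x → x ∈ p × φ x ≡ a)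
    project stop = _ , stop , λ { (here refl) → _ , here refl , refl }
    project (_◂_ {u} {v} {z} e w) with q , w′ , from ← project w | φ u W.≟ φ v
    ... | yes eq = q , subst (λ a → Walk (Quotient E φ) a (φ z) q) (≡.sym eq) w′ ,
                   λ a∈ → let x , x∈ , eq′ = from a∈ in x , there x∈ , eq′
    ... | no neq = _ , (neq , u , v , e , refl , refl) ◂ w′ ,
                   λ { (here refl) → u , here refl , refl
                     ; (there a∈) → let x , x∈ , eq′ = from a∈ in x , there x∈ , eq′ }

    Image : (V → Set) → W → Set
    Image X a = ∃ λ u → X u × φ u ≡ a

    image? : ∀ {X} → Decidable₁ X → Decidable₁ (Image X)
    image? X? a = exists? finV λ u → X? u ×-dec (φ u W.≟ a)

    module _ {Dom : V → Set} (dom : ∀ {u v} → E u v → Dom u × Dom v) (conn : ConnectedFibres E Dom φ) where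

      lift : ∀ {a b q u v} → Walk (Quotient E φ) a b q → Dom u → Dom v → φ u ≡ a → φ v ≡ b →
        ∃ λ p → Walk E u v p × (∀ {x} → x ∈ p → φ x ∈ q)
      lift stop Du Dv refl eq =
        let p , w , lab = conn Du Dv (≡.sym eq) in p , w , here ∘ lab
      lift ((_ , u′ , v′ , e , refl , refl) ◂ w) Du Dv eq eq′ =
        let p₁ , w₁ , lab₁ = conn Du (proj₁ (dom e)) eq
            p₂ , w₂ , lab₂ = lift w (proj₂ (dom e)) Dv refl eq′
        in  p₁ ++ p₂ , walk-join w₁ e w₂ ,
            λ x∈ → [ (λ x∈₁ → here (trans (lab₁ x∈₁) eq)) , there ∘ lab₂ ]′ (M.∈-++⁻ p₁ x∈)

      lift-family : ∀ {X Y k} → (∀ {v} → X v → Dom v) → (∀ {v} → Y v → Dom v) →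
        (Q : Family (Quotient E φ) (Image X) (Image Y) k) →
        Σ (Family E X Y k) λ P → ∀ i {x} → x ∈ path P i → φ x ∈ path Q i
      lift-family X⊆ Y⊆ Q = record
        { path  = λ i → proj₁ (lifted i)
        ; src   = λ i → proj₁ (src∈X Q i)
        ; dst   = λ i → proj₁ (dst∈Y Q i)
        ; walk  = λ i → proj₁ (proj₂ (lifted i))
        ; src∈X = λ i → proj₁ (proj₂ (src∈X Q i))
        ; dst∈Y = λ i → proj₁ (proj₂ (dst∈Y Q i))
        } , λ i → proj₂ (proj₂ (lifted i))
        where
        lifted = λ i → lift (walk Q i) (X⊆ (proj₁ (proj₂ (src∈X Q i)))) (Y⊆ (proj₁ (proj₂ (dst∈Y Q i))))
          (proj₂ (proj₂ (src∈X Q i))) (proj₂ (proj₂ (dst∈Y Q i)))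

      -- A lifted walk stays in the fibres of its own quotient path. The walks obtained therefore
      -- share not even a label, which is more than disjointness and is what later non-adjacency
      -- rests on.
      menger-quotient : ∀ {X Y} → Decidable₁ X → Decidable₁ Y → (∀ {v} → X v → Dom v) → (∀ {v} → Y v → Dom v) →
        ∀ k → Σ (Family E X Y k) (LabelDisjoint φ) ⊎
              ∃ λ S → length S < k × Separates E X Y (λ x → φ x ∈ S)
      menger-quotient X? Y? X⊆ Y⊆ k with menger quotient? (image? X?) (image? Y?) k
      ... | inj₁ (Q , disj) =
        let P , lab = lift-family X⊆ Y⊆ Q
        in  inj₁ (P , λ {i} {j} x∈ y∈ eq → disj (lab i x∈) (subst (_∈ path Q j) (≡.sym eq) (lab j y∈)))
      ... | inj₂ (S , |S|<k , sep) = inj₂ (S , |S|<k , λ Xa Yb w →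
        let q , w′ , from   = project w
            a , a∈q , a∈S   = sep (_ , Xa , refl) (_ , Yb , refl) w′
            x , x∈p , eq    = from a∈q
        in  x , x∈p , subst (_∈ S) (≡.sym eq) a∈S)

  length-concatMap-≤ : ∀ {A B : Set} (f : A → List B) c → (∀ a → length (f a) ≤ c) → ∀ xs →
    length (concatMap f xs) ≤ c * length xs
  length-concatMap-≤ f c bound [] = z≤n
  length-concatMap-≤ f c bound (x ∷ xs) = begin
    length (f x ++ concatMap f xs)           ≡⟨ length-++ (f x) ⟩
    length (f x) + length (concatMap f xs)   ≤⟨ ℕ.+-mono-≤ (bound x) (length-concatMap-≤ f c bound xs) ⟩
    c + c * length xs                        ≡⟨ ℕ.*-suc c (length xs) ⟨
    c * suc (length xs)                      ∎
    where open ℕ.≤-Reasoning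

  -- This is k / c rounded up. Its minimality is given in the form needed for separators: fewer than
  -- `l` labels, each blocking at most `c` paths, block fewer than `k` paths.
  ceiling : ∀ c → 1 ≤ c → ∀ k → ∃ λ l → k ≤ c * l × (∀ {j} → j < l → c * j < k)
  ceiling c 1≤c zero = 0 , z≤n , λ ()
  ceiling c 1≤c (suc k) with ceiling c 1≤c k
  ... | l , k≤ , below with suc k ℕ.≤? c * l
  ...   | yes k<  = l , k< , λ j<l → ℕ.m<n⇒m<1+n (below j<l)
  ...   | no k≮ = suc l , bound , λ j<1+l → s≤s (ℕ.≤-trans (ℕ.*-monoʳ-≤ c (ℕ.≤-pred j<1+l)) (ℕ.≤-pred (ℕ.≰⇒> k≮)))
    where
    bound : suc k ≤ c * suc l
    bound = ℕ.≤-trans (ℕ.+-mono-≤ 1≤c k≤) (ℕ.≤-reflexive (≡.sym (ℕ.*-suc c l)))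

  -- If every fibre of φ meets at most c of the given disjoint paths, then a set of labels
  -- separating X from Y in the quotient has at least k / c elements.
  module Thinning {V W : Set} (finV : Finite V) (finW : Finite W)
    {E : V → V → Set} (E? : Decidable E) (φ : V → W)
    {Dom : V → Set} (dom : ∀ {u v} → E u v → Dom u × Dom v) (conn : ConnectedFibres E Dom φ) where
    open Quotients finV finW E? φ
    open import Data.List.Membership.DecPropositional (Finite._≟_ finW) using (_∈?_)

    thin : ∀ {X Y k c} → Decidable₁ X → Decidable₁ Y → (∀ {v} → X v → Dom v) → (∀ {v} → Y v → Dom v) →
      1 ≤ c → (P : Family E X Y k) → Disjoint P →
      (hit : W → List V) → (∀ a → length (hit a) ≤ c) →
      (∀ {i x} → x ∈ path P i → ∃ λ y → y ∈ path P i × y ∈ hit (φ x)) →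
      ∃ λ l → k ≤ c * l × Σ (Family E X Y l) (LabelDisjoint φ)
    thin {k = k} {c} X? Y? X⊆ Y⊆ 1≤c P disj hit |hit|≤c hits with l , k≤ , below ← ceiling c 1≤c k
      with menger-quotient dom conn X? Y? X⊆ Y⊆ l
    ... | inj₁ found = l , k≤ , found
    ... | inj₂ (S , |S|<l , sep) = ⊥-elim (ℕ.<-irrefl refl (begin-strict
        k                             ≤⟨ injective⇒≤length (proj₁ ∘ chosen) (proj₂ ∘ proj₂ ∘ chosen) injective ⟩
        length (concatMap hit S)      ≤⟨ length-concatMap-≤ hit c |hit|≤c S ⟩
        c * length S                  <⟨ below |S|<l ⟩
        k                             ∎))
      where
      open ℕ.≤-Reasoning
      chosen : ∀ i → ∃ λ y → y ∈ path P i × y ∈ concatMap hit S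
      chosen i =
        let x , x∈ , φx∈S = sep (src∈X P i) (dst∈Y P i) (walk P i)
            y , y∈ , y∈hit = hits x∈
        in  y , y∈ , M.∈-concatMap⁺ hit (Any.map (λ { refl → y∈hit }) φx∈S)
      injective : ∀ {i j} → proj₁ (chosen i) ≡ proj₁ (chosen j) → i ≡ j
      injective {i} {j} eq = disj (proj₁ (proj₂ (chosen i)))
        (subst (_∈ path P j) (≡.sym eq) (proj₁ (proj₂ (chosen j))))

  -- Induced paths

  module InducedPaths {V : Set} (_≟_ : DecidableEquality V) {E : V → V → Set} (E? : Decidable E)
    (E-sym : Symmetric E) (E-irrefl : ∀ {v} → ¬ E v v) where
    open import Data.List.Membership.DecPropositional _≟_ using (_∈?_)

    data InducedPath : V → V → List V → Set where
      stop : ∀ {v} → InducedPath v v (v ∷ [])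
      cons : ∀ {u v w p} → E u v → u ∉ v ∷ p → (∀ {x} → x ∈ p → ¬ E u x) →
             InducedPath v w (v ∷ p) → InducedPath u w (u ∷ v ∷ p)

    toWalk : ∀ {a b p} → InducedPath a b p → Walk E a b p
    toWalk stop = stop
    toWalk (cons e _ _ π) = e ◂ toWalk π

    unique : ∀ {a b p} → InducedPath a b p → Unique p
    unique stop = [] AllPairs.∷ AllPairs.[]
    unique (cons _ u∉ _ π) = All.tabulate (λ { x∈ refl → u∉ x∈ }) AllPairs.∷ unique π

    suffix : ∀ {a b x p} → InducedPath a b p → x ∈ p → ∃ λ q → InducedPath x b q × (∀ {y} → y ∈ q → y ∈ p)
    suffix stop (here refl) = _ , stop , id
    suffix π@(cons _ _ _ _) (here refl) = _ , π , id
    suffix (cons _ _ _ π) (there x∈) = let q , π′ , sub = suffix π x∈ in q , π′ , there ∘ sub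

    -- The new vertex is joined to its last neighbour on the path, so nothing after that neighbour
    -- is adjacent to it.
    extend : ∀ {u a b p} → InducedPath a b p → u ∉ p → Any (E u) p →
      ∃ λ q → InducedPath u b q × (∀ {y} → y ∈ q → y ∈ u ∷ p)
    extend stop u∉ (here e) = _ , cons e u∉ (λ ()) stop , id
    extend {u} (cons {u = c} {p = p} e c∉ ¬E π) u∉ adj with any? (E? u) (_ ∷ p)
    ... | yes adj′ =
      let q , π′ , sub = extend π (u∉ ∘ there) adj′
      in  q , π′ , λ y∈ → case sub y∈ of λ { (here refl) → here refl ; (there y∈p) → there (there y∈p) }
    ... | no ¬adj with adj
    ...   | here e′ = _ , cons e′ u∉ (λ x∈ e″ → ¬adj (Any.map (λ { refl → e″ }) x∈)) (cons e c∉ ¬E π) , id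
    ...   | there adj′ = ⊥-elim (¬adj adj′)

    shortcut : ∀ {a b p} → Walk E a b p → ∃ λ q → InducedPath a b q × (∀ {y} → y ∈ q → y ∈ p)
    shortcut stop = _ , stop , id
    shortcut (_◂_ {u} e w) with q , π , sub ← shortcut w with u ∈? q
    ... | yes u∈q = let q′ , π′ , sub′ = suffix π u∈q in q′ , π′ , there ∘ sub ∘ sub′
    ... | no u∉q =
      let q′ , π′ , sub′ = extend π u∉q (Any.map (λ { refl → e }) (walk-start (toWalk π)))
      in  q′ , π′ , λ y∈ → case sub′ y∈ of λ { (here refl) → here refl ; (there y∈q) → there (sub y∈q) }

    -- A neighbour of a vertex on a path is a vertex, or one of two virtual neighbours of
    -- the first (true) and of the last (false) vertex; a path gives each of its vertices two.
    Ext : Set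
    Ext = V ⊎ Bool

    NeighbourOn : Ext → V → V → List V → V → Ext → Set
    NeighbourOn e₀ a b p v e =
      (e ≡ e₀ × v ≡ a) ⊎ (∃ λ w → e ≡ inj₁ w × w ∈ p × E v w) ⊎ (e ≡ inj₂ false × v ≡ b)

    -- `e₀` stands for whatever precedes the first vertex. It is a parameter for the sake of the
    -- induction: when the first vertex is removed, it becomes the `e₀` of the remaining path.
    two-neighbours : ∀ {a b p} e₀ → InducedPath a b p →
      (∀ {x} → x ∈ p → e₀ ≢ inj₁ x) → e₀ ≢ inj₂ false → ∀ {v} → v ∈ p →
      ∃ λ e₁ → ∃ λ e₂ → e₁ ≢ e₂ × NeighbourOn e₀ a b p v e₁ × NeighbourOn e₀ a b p v e₂ ×
        (∀ {e} → NeighbourOn e₀ a b p v e → e ≡ e₁ ⊎ e ≡ e₂)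
    two-neighbours e₀ stop e₀∉ e₀≢ (here refl) =
      e₀ , inj₂ false , e₀≢ , inj₁ (refl , refl) , inj₂ (inj₂ (refl , refl)) ,
      λ { (inj₁ (eq , _)) → inj₁ eq
        ; (inj₂ (inj₁ (_ , _ , here refl , e))) → ⊥-elim (E-irrefl e)
        ; (inj₂ (inj₂ (eq , _))) → inj₂ eq }
    two-neighbours e₀ (cons {u} {v} {w} {p} e u∉ ¬E π) e₀∉ e₀≢ (here refl) =
      e₀ , inj₁ v , e₀∉ (there (here refl)) , inj₁ (refl , refl) , inj₂ (inj₁ (v , refl , there (here refl) , e)) ,
      λ { (inj₁ (eq , _)) → inj₁ eq
        ; (inj₂ (inj₁ (_ , _ , here refl , e))) → ⊥-elim (E-irrefl e)
        ; (inj₂ (inj₁ (_ , eq , there (here refl) , _))) → inj₂ eq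
        ; (inj₂ (inj₁ (_ , _ , there (there x∈) , e))) → ⊥-elim (¬E x∈ e)
        ; (inj₂ (inj₂ (_ , refl))) → ⊥-elim (u∉ (walk-end (toWalk π))) }
    two-neighbours e₀ (cons {u} {v} {w} {p} e u∉ ¬E π) e₀∉ e₀≢ {x} (there x∈)
      with e₁ , e₂ , e₁≢e₂ , n₁ , n₂ , only ← two-neighbours (inj₁ u) π (λ { y∈ refl → u∉ y∈ }) (λ ()) x∈ =
      e₁ , e₂ , e₁≢e₂ , outer n₁ , outer n₂ , only ∘ inner x∈
      where
      outer : ∀ {e} → NeighbourOn (inj₁ u) v w (v ∷ p) x e → NeighbourOn e₀ u w (u ∷ v ∷ p) x e
      outer (inj₁ (refl , refl)) = inj₂ (inj₁ (u , refl , here refl , E-sym e))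
      outer (inj₂ (inj₁ (y , eq , y∈ , e′))) = inj₂ (inj₁ (y , eq , there y∈ , e′))
      outer (inj₂ (inj₂ eqs)) = inj₂ (inj₂ eqs)
      inner : ∀ {x e} → x ∈ v ∷ p → NeighbourOn e₀ u w (u ∷ v ∷ p) x e → NeighbourOn (inj₁ u) v w (v ∷ p) x e
      inner x∈ (inj₁ (_ , refl)) = ⊥-elim (u∉ x∈)
      inner (here refl) (inj₂ (inj₁ (_ , eq , here refl , e′))) = inj₁ (eq , refl)
      inner (there x∈p) (inj₂ (inj₁ (_ , eq , here refl , e′))) = ⊥-elim (¬E x∈p (E-sym e′))
      inner _ (inj₂ (inj₁ (y , eq , there y∈ , e′))) = inj₂ (inj₁ (y , eq , y∈ , e′))
      inner _ (inj₂ (inj₂ eqs)) = inj₂ (inj₂ eqs)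

  -- Graphs of bounded degree

  fresh : ∀ {A : Set} {C} → DecidableEquality A → (f : Fin C → A) → (∀ {i j} → f i ≡ f j → i ≡ j) →
    ∀ L → length L < C → ∃ λ c → f c ∉ L
  fresh {A} {C} _≟_ f inj L |L|<C with F.any? (λ c → ¬? (f c ∈? L))
    where open import Data.List.Membership.DecPropositional _≟_ using (_∈?_)
  ... | yes found = found
  ... | no none = ⊥-elim (ℕ.<-irrefl refl (ℕ.≤-trans |L|<C (injective⇒≤length f all∈ inj)))
    where
    open import Data.List.Membership.DecPropositional _≟_ using (_∈?_)
    all∈ : ∀ c → f c ∈ L
    all∈ c = decidable-stable (f c ∈? L) (λ c∉ → none (c , c∉))

  NonAdjacent : {V : Set} {E : V → V → Set} {X Y : V → Set} {k : ℕ} → Family E X Y k → Set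
  NonAdjacent {E = E} P = ∀ {i j x y} → x ∈ path P i → y ∈ path P j → E x y → i ≡ j

  -- A greedy colouring has to avoid the colours in the closed neighbourhoods of all members of one
  -- closed neighbourhood, at most (Δ + 1)² many.
  colours : ℕ → ℕ
  colours Δ = suc (suc Δ * suc Δ)

  -- There is one round for each colour, and each costs a factor Δ + 1.
  degreeFactor : ℕ → ℕ
  degreeFactor Δ = suc Δ ^ colours Δ

  module BoundedDegree {V : Set} (fin : Finite V) {E : V → V → Set} (E? : Decidable E)
    (E-sym : Symmetric E) (E-irrefl : ∀ {v} → ¬ E v v)
    (Δ : ℕ) (nb : V → List V) (|nb|≤Δ : ∀ v → length (nb v) ≤ Δ) (nb-complete : ∀ {u v} → E u v → v ∈ nb u) where
    open Finite fin
    open InducedPaths _≟_ E? E-sym E-irrefl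
    open import Data.List.Membership.DecPropositional _≟_ using (_∈?_)

    Close : V → V → Set
    Close u v = u ≡ v ⊎ E v u

    close? : Decidable Close
    close? u v = (u ≟ v) ⊎-dec E? v u

    ball : V → List V
    ball v = v ∷ nb v

    close∈ball : ∀ {u v} → Close u v → v ∈ ball u
    close∈ball (inj₁ refl) = here refl
    close∈ball (inj₂ e)    = there (nb-complete (E-sym e))

    close∈ball′ : ∀ {u v} → Close u v → u ∈ ball v
    close∈ball′ (inj₁ refl) = here refl
    close∈ball′ (inj₂ e)    = there (nb-complete e)

    Distance2Colouring : List V → (V → Fin (colours Δ)) → Set
    Distance2Colouring L col = ∀ {u u′ x} → u ∈ L → u′ ∈ L → Close u x → Close u′ x → col u ≡ col u′ → u ≡ u′

    abstract
      colour-list : ∀ L → ∃ (Distance2Colouring L)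
      colour-list [] = (λ _ → zero) , λ ()
      colour-list (v ∷ L) with col , proper ← colour-list L
        with c , c∉ ← fresh F._≟_ id id (map col (concatMap ball (ball v)))
          (s≤s (ℕ.≤-trans (ℕ.≤-reflexive (length-map col (concatMap ball (ball v))))
            (ℕ.≤-trans (length-concatMap-≤ ball (suc Δ) (λ u → s≤s (|nb|≤Δ u)) (ball v))
              (ℕ.*-monoʳ-≤ (suc Δ) (s≤s (|nb|≤Δ v))))))
        = col′ , proper′
        where
        col′ : V → Fin (colours Δ)
        col′ u with u ≟ v
        ... | yes _ = c
        ... | no  _ = col u
        tail : ∀ {u} → u ≢ v → u ∈ v ∷ L → u ∈ L
        tail u≢v (here eq) = ⊥-elim (u≢v eq)
        tail u≢v (there u∈) = u∈
        clash : ∀ {u x} → Close v x → Close u x → c ≢ col u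
        clash cv cu refl = c∉ (M.∈-map⁺ col (M.∈-concatMap⁺ ball (Any.map (λ { refl → close∈ball′ cu }) (close∈ball cv))))
        proper′ : Distance2Colouring (v ∷ L) col′
        proper′ {u} {u′} u∈ u′∈ cu cu′ eq with u ≟ v | u′ ≟ v
        ... | yes refl | yes refl = refl
        ... | yes refl | no _     = ⊥-elim (clash cu cu′ eq)
        ... | no _     | yes refl = ⊥-elim (clash cu′ cu (≡.sym eq))
        ... | no u≢    | no u′≢   = proper (tail u≢ u∈) (tail u′≢ u′∈) cu cu′ eq

    col : V → Fin (colours Δ)
    col = proj₁ (colour-list elements)

    col-proper : ∀ {u u′ x} → Close u x → Close u′ x → col u ≡ col u′ → u ≡ u′
    col-proper = proj₂ (colour-list elements) (complete _) (complete _)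

    module _ {X Y : V → Set} where

      On : ∀ {k} → Family E X Y k → V → Set
      On P v = ∃ λ i → v ∈ path P i

      Neighbour : ∀ {k} → Family E X Y k → V → Ext → Set
      Neighbour P v (inj₁ w)     = E v w × On P w
      Neighbour P v (inj₂ true)  = ∃ λ i → v ≡ src P i
      Neighbour P v (inj₂ false) = ∃ λ i → v ≡ dst P i

      -- A vertex with at most two neighbours (virtual ones included) in a system of paths
      -- has all its neighbours on its own path, in this system and in all systems inside it.
      Settled : ∀ {k} → Family E X Y k → V → Set
      Settled P v = ∃ λ e₁ → ∃ λ e₂ → ∀ {e} → Neighbour P v e → e ≡ e₁ ⊎ e ≡ e₂

      record Refines {k l} (Q : Family E X Y l) (P : Family E X Y k) : Set where
        field
          on⊆  : ∀ {v} → On Q v → On P v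
          src⊆ : ∀ i → ∃ λ j → src Q i ≡ src P j
          dst⊆ : ∀ i → ∃ λ j → dst Q i ≡ dst P j
      open Refines

      settled-refine : ∀ {k l} {Q : Family E X Y l} {P : Family E X Y k} → Refines Q P → ∀ {v} → Settled P v → Settled Q v
      settled-refine {Q = Q} {P} ref {v} (e₁ , e₂ , only) = e₁ , e₂ , λ {e} n → only {e} (mono e n)
        where
        mono : ∀ e → Neighbour Q v e → Neighbour P v e
        mono (inj₁ w)     (e , on)   = e , on⊆ ref on
        mono (inj₂ true)  (i , refl) = src⊆ ref i
        mono (inj₂ false) (i , refl) = dst⊆ ref i

      record InducedFamily (k : ℕ) : Set where
        field
          family   : Family E X Y k
          disjoint : Disjoint family
          induced  : ∀ i → InducedPath (src family i) (dst family i) (path family i)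

        induced-neighbours : ∀ {i v} → v ∈ path family i → _
        induced-neighbours {i} v∈ = two-neighbours (inj₂ true) (induced i) (λ _ ()) (λ ()) v∈

      open InducedFamily

      module Round {k : ℕ} (F : InducedFamily k) (c : Fin (colours Δ)) where
        P = family F

        on? : Decidable₁ (On P)
        on? v = F.any? (λ i → v ∈? path P i)

        E′ : V → V → Set
        E′ u v = E u v × On P u × On P v

        E′? : Decidable E′
        E′? u v = E? u v ×-dec on? u ×-dec on? v

        Centre : V → V → Set
        Centre v u = col u ≡ c × On P u × On P v × Close u v

        centre? : ∀ v → Dec (∃ (Centre v))
        centre? v = exists? fin λ u → (col u F.≟ c) ×-dec on? u ×-dec on? v ×-dec close? u v

        φ : V → V
        φ v with centre? v
        ... | yes (u , _) = u
        ... | no _        = v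

        φ-centre : ∀ {u v} → Centre v u → φ v ≡ u
        φ-centre {u} {v} cen@(cu , _ , _ , cl) with centre? v
        ... | yes (u′ , cu′ , _ , _ , cl′) = col-proper cl′ cl (trans cu′ (≡.sym cu))
        ... | no none = ⊥-elim (none (u , cen))

        φ-close : ∀ v → Close (φ v) v
        φ-close v with centre? v
        ... | yes (u , _ , _ , _ , cl) = cl
        ... | no _ = inj₁ refl

        to-label : ∀ {v} → On P v → ∃ λ p → Walk E′ v (φ v) p × (∀ {x} → x ∈ p → φ x ≡ φ v)
        to-label {v} on with centre? v in eq
        ... | no _ = _ , stop , λ { (here refl) → φv }
          where
          φv : φ v ≡ v
          φv rewrite eq = refl
        ... | yes (u , cen@(cu , onu , onv , cl)) = go cl
          where
          φu : φ u ≡ u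
          φu = φ-centre (cu , onu , onu , inj₁ refl)
          go : Close u v → ∃ λ p → Walk E′ v u p × (∀ {x} → x ∈ p → φ x ≡ u)
          go (inj₁ refl) = _ , stop , λ { (here refl) → φu }
          go (inj₂ e)    = _ , (e , onv , onu) ◂ stop , λ { (here refl) → φ-centre cen ; (there (here refl)) → φu }

        connected : ConnectedFibres E′ (On P) φ
        connected {u} {v} onu onv eq =
          let _ , w₁ , lab₁ = to-label onu
              _ , w₂ , lab₂ = to-label onv
              _ , w₂′ , sub = walk-reverse (λ (e , a , b) → E-sym e , b , a) w₂
              q , w , split = walk-trans w₁ (subst (λ a → Walk E′ a v _) (≡.sym eq) w₂′)
          in  q , w , λ x∈ → [ lab₁ , (λ x∈₂ → trans (lab₂ (sub x∈₂)) (≡.sym eq)) ]′ (split x∈)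

        -- The new paths run between the old ends and not between arbitrary vertices of `X` and `Y`.
        -- Otherwise a vertex might become an end in a later round and gain a virtual neighbour, and
        -- settled vertices might not stay settled.
        Srcs Dsts : V → Set
        Srcs v = ∃ λ i → v ≡ src P i
        Dsts v = ∃ λ i → v ≡ dst P i

        rows : Family E′ Srcs Dsts k
        rows = record
          { path  = path P
          ; src   = src P
          ; dst   = dst P
          ; walk  = λ i → walk-map (λ u∈ v∈ e → e , (i , u∈) , (i , v∈)) (walk P i)
          ; src∈X = λ i → i , refl
          ; dst∈Y = λ i → i , refl
          }

        abstract
          thinned : ∃ λ l → k ≤ suc Δ * l × Σ (Family E′ Srcs Dsts l) (LabelDisjoint φ)
          -- The fibre of a label lies in the closed neighbourhood of that label, so `ball` lists at
          -- most Δ + 1 vertices that account for all paths through the fibre.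
          thinned = Thinning.thin fin fin E′? φ proj₂ connected
            (λ v → F.any? (λ i → v ≟ src P i)) (λ v → F.any? (λ i → v ≟ dst P i))
            (λ { (i , refl) → i , walk-start (walk P i) }) (λ { (i , refl) → i , walk-end (walk P i) })
            (s≤s z≤n) rows (disjoint F) ball (λ a → s≤s (|nb|≤Δ a))
            (λ {i} {x} x∈ → x , x∈ , close∈ball (φ-close x))

        l = proj₁ thinned
        Q₀ = proj₁ (proj₂ (proj₂ thinned))
        Q₀-labels = proj₂ (proj₂ (proj₂ thinned))

        abstract
          short : ∀ i → ∃ λ q → InducedPath (src Q₀ i) (dst Q₀ i) q × (∀ {y} → y ∈ q → y ∈ path Q₀ i)
          short i = shortcut (walk-map (λ _ _ → proj₁) (walk Q₀ i))

        Q : InducedFamily l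
        Q = record
          { family = record
            { path  = λ i → proj₁ (short i)
            ; src   = src Q₀
            ; dst   = dst Q₀
            ; walk  = λ i → toWalk (proj₁ (proj₂ (short i)))
            ; src∈X = λ i → subst X (≡.sym (proj₂ (src∈X Q₀ i))) (src∈X P (proj₁ (src∈X Q₀ i)))
            ; dst∈Y = λ i → subst Y (≡.sym (proj₂ (dst∈Y Q₀ i))) (dst∈Y P (proj₁ (dst∈Y Q₀ i)))
            }
          ; disjoint = λ {i} {j} x∈ x∈′ → Q₀-labels (proj₂ (proj₂ (short i)) x∈) (proj₂ (proj₂ (short j)) x∈′) refl
          ; induced = λ i → proj₁ (proj₂ (short i))
          }

        refines : Refines (family Q) P
        refines = record
          { on⊆  = λ (i , v∈) → walk-all (λ e → proj₂ (proj₂ e)) (start i) (walk Q₀ i) (proj₂ (proj₂ (short i)) v∈)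
          ; src⊆ = src∈X Q₀
          ; dst⊆ = dst∈Y Q₀
          }
          where
          start : ∀ i → On P (src Q₀ i)
          start i with j , eq ← src∈X Q₀ i = j , subst (_∈ path P j) (≡.sym eq) (walk-start (walk P j))

        -- The neighbours of a centre that remain in the system carry its label, and different new
        -- paths share no label. So they all lie on the path of the centre, and this path is
        -- induced.
        settled : ∀ {v} → On (family Q) v → col v ≡ c → Settled (family Q) v
        settled {v} (i , v∈) cv with e₁ , e₂ , _ , _ , _ , only ← induced-neighbours Q v∈ =
          e₁ , e₂ , λ {e} n → only (own e n)
          where
          φv : φ v ≡ v
          φv = φ-centre (cv , on⊆ refines (i , v∈) , on⊆ refines (i , v∈) , inj₁ refl)
          own : ∀ e → Neighbour (family Q) v e →
            NeighbourOn (inj₂ true) (src (family Q) i) (dst (family Q) i) (path (family Q) i) v e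
          own (inj₁ w) (e , j , w∈)
            with Q₀-labels (proj₂ (proj₂ (short i)) v∈) (proj₂ (proj₂ (short j)) w∈)
              (trans φv (≡.sym (φ-centre (cv , on⊆ refines (i , v∈) , on⊆ refines (j , w∈) , inj₂ (E-sym e)))))
          ... | refl = inj₂ (inj₁ (w , refl , w∈ , e))
          own (inj₂ true) (j , refl) with disjoint Q v∈ (walk-start (walk (family Q) j))
          ... | refl = inj₁ (refl , refl)
          own (inj₂ false) (j , refl) with disjoint Q v∈ (walk-end (walk (family Q) j))
          ... | refl = inj₂ (inj₂ (refl , refl))

      process : ∀ {k} → InducedFamily k → ∀ cs → ∃ λ l → k ≤ suc Δ ^ length cs * l ×
        Σ (InducedFamily l) λ Q → ∀ {v} → On (family Q) v → col v ∈ cs → Settled (family Q) v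
      process {k} F [] = k , ℕ.≤-reflexive (≡.sym (ℕ.*-identityˡ k)) , F , λ _ ()
      process {k} F (c ∷ cs) with l , k≤ , F′ , settled′ ← process F cs =
        R.l , bound , R.Q , λ { on (here cv) → R.settled on cv
                              ; on (there c∈) → settled-refine R.refines (settled′ (on⊆ R.refines on) c∈) }
        where
        module R = Round F′ c
        open ℕ.≤-Reasoning
        bound : k ≤ suc Δ ^ suc (length cs) * R.l
        bound = begin
          k                                    ≤⟨ k≤ ⟩
          suc Δ ^ length cs * l                ≤⟨ ℕ.*-monoʳ-≤ (suc Δ ^ length cs) (proj₁ (proj₂ R.thinned)) ⟩
          suc Δ ^ length cs * (suc Δ * R.l)    ≡⟨ ℕ.*-assoc (suc Δ ^ length cs) (suc Δ) R.l ⟨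
          suc Δ ^ length cs * suc Δ * R.l      ≡⟨ cong (_* R.l) (ℕ.*-comm (suc Δ ^ length cs) (suc Δ)) ⟩
          suc Δ ^ suc (length cs) * R.l        ∎

      nonadjacent-paths : ∀ {k} (P : Family E X Y k) → Disjoint P → ∃ λ l → k ≤ degreeFactor Δ * l ×
        Σ (Family E X Y l) λ Q → Disjoint Q × NonAdjacent Q
      nonadjacent-paths {k} P disj with process start (allFin (colours Δ))
        where
        short = λ i → shortcut (walk P i)
        start : InducedFamily k
        start = record
          { family = record
            { path  = λ i → proj₁ (short i)
            ; src   = src P
            ; dst   = dst P
            ; walk  = λ i → toWalk (proj₁ (proj₂ (short i)))
            ; src∈X = src∈X P
            ; dst∈Y = dst∈Y P
            }
          ; disjoint = λ {i} {j} x∈ x∈′ → disj (proj₂ (proj₂ (short i)) x∈) (proj₂ (proj₂ (short j)) x∈′)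
          ; induced = λ i → proj₁ (proj₂ (short i))
          }
      ... | l , k≤ , F , settled =
        l , subst (λ e → k ≤ suc Δ ^ e * l) (length-tabulate {n = colours Δ} id) k≤ , family F , disjoint F , nonadj
        where
        to : ∀ {i v} → ∀ e → v ∈ path (family F) i →
          NeighbourOn (inj₂ true) (src (family F) i) (dst (family F) i) (path (family F) i) v e → Neighbour (family F) v e
        to _ v∈ (inj₁ (refl , eq)) = _ , eq
        to _ v∈ (inj₂ (inj₁ (w , refl , w∈ , e))) = e , _ , w∈
        to _ v∈ (inj₂ (inj₂ (refl , eq))) = _ , eq
        -- The path of `x` gives it two distinct neighbours, and being settled allows only two in
        -- the whole system. So `y` is one of those on the path; virtual neighbours make this work
        -- at the ends as well.
        nonadj : NonAdjacent (family F)
        nonadj {i} {j} {x} {y} x∈ y∈ e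
          with f₁ , f₂ , only ← settled (i , x∈) (M.∈-allFin (col x))
          with e₁ , e₂ , e₁≢e₂ , n₁ , n₂ , only′ ← induced-neighbours F x∈
          = disjoint F (y∈i _ _ _ _ e₁≢e₂ (only (to e₁ x∈ n₁)) (only (to e₂ x∈ n₂)) (only {inj₁ y} (e , j , y∈)) n₁ n₂) y∈
          where
          vertex : NeighbourOn (inj₂ true) (src (family F) i) (dst (family F) i) (path (family F) i) x (inj₁ y) → y ∈ path (family F) i
          vertex (inj₁ (() , _))
          vertex (inj₂ (inj₁ (_ , refl , y∈ , _))) = y∈
          vertex (inj₂ (inj₂ (() , _)))
          N = NeighbourOn (inj₂ true) (src (family F) i) (dst (family F) i) (path (family F) i) x
          y∈i : ∀ f₁ f₂ e₁ e₂ → e₁ ≢ e₂ → e₁ ≡ f₁ ⊎ e₁ ≡ f₂ → e₂ ≡ f₁ ⊎ e₂ ≡ f₂ → inj₁ y ≡ f₁ ⊎ inj₁ y ≡ f₂ →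
            N e₁ → N e₂ → y ∈ path (family F) i
          y∈i _ _ _ _ ne (inj₁ refl) (inj₁ refl) _ _ _ = ⊥-elim (ne refl)
          y∈i _ _ _ _ ne (inj₂ refl) (inj₂ refl) _ _ _ = ⊥-elim (ne refl)
          y∈i _ _ _ _ ne (inj₁ refl) (inj₂ refl) (inj₁ refl) n₁ n₂ = vertex n₁
          y∈i _ _ _ _ ne (inj₁ refl) (inj₂ refl) (inj₂ refl) n₁ n₂ = vertex n₂
          y∈i _ _ _ _ ne (inj₂ refl) (inj₁ refl) (inj₁ refl) n₁ n₂ = vertex n₂
          y∈i _ _ _ _ ne (inj₂ refl) (inj₁ refl) (inj₂ refl) n₁ n₂ = vertex n₁

  -- Contracting regions behind small cuts

  -- Successive contraction of the regions Z v that a small set S v cuts off from v: since a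
  -- fibre never leaves Z v, it meets only paths that meet S v.
  module Contraction {V : Set} (fin : Finite V) {E : V → V → Set} (E? : Decidable E) (E-sym : Symmetric E)
    {Dom : V → Set} (Dom? : Decidable₁ Dom) (dom : ∀ {u v} → E u v → Dom u × Dom v)
    {X Y : V → Set} {k s : ℕ} (1≤s : 1 ≤ s)
    (P : Family E X Y k) (P⊆Dom : ∀ {i x} → x ∈ path P i → Dom x)
    (cut : ∀ v → Dom v → ∃ λ S → length S ≤ s × v ∉ S ×
      (∀ {i x p} → Walk (Entering E (_∈ S)) v x p → x ∈ path P i → ∃ λ y → y ∈ path P i × y ∈ S)) where
    open Finite fin
    open import Data.List.Membership.DecPropositional _≟_ using (_∈?_)

    Small : (V → V) → V → Set
    Small φ a = ∃ λ N → length N ≤ s × (∀ {u u′} → E u u′ → φ u ≡ a → φ u′ ≢ a → φ u′ ∈ N)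

    Trivial : (V → V) → V → Set
    Trivial φ a = ∀ {u} → Dom u → φ u ≡ a → u ≡ a

    -- Invariant of the contraction. `hit` and `hits` have the form that `Thinning.thin` consumes.
    -- By `status`, a label that does not yet have small degree still has nothing but itself in its
    -- fibre, so its own cut can be applied to it.
    record Partial (L : List V) : Set where
      field
        φ         : V → V
        connected : ConnectedFibres E Dom φ
        hit       : V → List V
        |hit|≤s   : ∀ a → length (hit a) ≤ s
        hits      : ∀ {i x} → x ∈ path P i → ∃ λ y → y ∈ path P i × y ∈ hit (φ x)
        small     : ∀ {a} → a ∈ L → Small φ a
        status    : ∀ a → Small φ a ⊎ Trivial φ a

    mark : ∀ {L v} (C : Partial L) → Small (Partial.φ C) v → Partial (v ∷ L)
    mark C sm = record
      { φ = φ ; connected = connected ; hit = hit ; |hit|≤s = |hit|≤s ; hits = hits ; status = status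
      ; small = λ { (here refl) → sm ; (there a∈) → small a∈ } }
      where open Partial C

    module Contract {L : List V} (C : Partial L) {v : V} (Dv : Dom v) (triv : Trivial (Partial.φ C) v) (φv : Partial.φ C v ≡ v) where
      open Partial C
      S = proj₁ (cut v Dv)
      v∉S : v ∉ S
      v∉S = proj₁ (proj₂ (proj₂ (cut v Dv)))
      module Q = Quotients fin fin E? φ

      T : List V
      T = map φ S

      -- The region is taken in the current quotient and not in the graph, so earlier fibres are
      -- absorbed as a whole or not at all.
      Z : V → Set
      Z a = ∃ λ q → Walk (Entering (Quotient E φ) (_∈ T)) v a q

      Dom-S : ∀ {x} → x ∈ S → φ x ≡ v → ¬ Dom x
      Dom-S x∈S eq Dx with triv Dx eq
      ... | refl = v∉S x∈S

      Z? : Decidable₁ Z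
      Z? a = MengerTheorem.reachable? fin (λ x y → Q.quotient? x y ×-dec ¬? (y ∈? T)) v a

      ψ : V → V
      ψ a with Z? a
      ... | yes _ = v
      ... | no _  = a

      ψ-in : ∀ {a} → Z a → ψ a ≡ v
      ψ-in {a} Za with Z? a
      ... | yes _ = refl
      ... | no ¬Za = ⊥-elim (¬Za Za)

      ψ-out : ∀ {a} → ¬ Z a → ψ a ≡ a
      ψ-out {a} ¬Za with Z? a
      ... | yes Za = ⊥-elim (¬Za Za)
      ... | no _ = refl

      Z-v : Z v
      Z-v = _ , stop

      φ′ : V → V
      φ′ = ψ ∘ φ

      outside : ∀ {u} → φ′ u ≢ v → ¬ Z (φ u)
      outside ne Zu = ne (ψ-in Zu)

      inside : ∀ {u} → φ′ u ≡ v → Z (φ u)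
      inside {u} eq with Z? (φ u)
      ... | yes Zu = Zu
      ... | no _ = subst Z (≡.sym eq) Z-v

      -- `T` contains the labels of all of `S`, so a label walk that avoids `T` lifts to a walk that
      -- avoids `S`. Only the initial label `v` may belong to `T`, but its fibre in `Dom` is `v`
      -- alone, and `v` is not in `S`.
      reach : ∀ {u} → Dom u → Z (φ u) → ∃ λ p → Walk E v u p × (∀ {x} → x ∈ p → Z (φ x) × (Dom x → x ∉ S))
      reach {u} Du (q , w) =
        let p , w′ , lab = Q.lift dom connected (walk-map (λ _ _ → proj₁) w) Dv Du φv refl
        in  p , w′ , λ {x} x∈ →
            let q′ , w″ , _ = walk-prefix w (lab x∈)
            in  (q′ , w″) , λ Dx x∈S → case entered w″ of λ
                  { (inj₁ eq) → Dom-S x∈S eq Dx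
                  ; (inj₂ φx∉T) → φx∉T (M.∈-map⁺ φ x∈S) }
        where
        entered : ∀ {a b p} → Walk (Entering (Quotient E φ) (_∈ T)) a b p → b ≡ a ⊎ b ∉ T
        entered stop = inj₁ refl
        entered ((_ , v∉T) ◂ w) with entered w
        ... | inj₁ refl = inj₂ v∉T
        ... | inj₂ b∉T = inj₂ b∉T

      connected′ : ConnectedFibres E Dom φ′
      connected′ {u} {u′} Du Du′ eq with Z? (φ u) | Z? (φ u′)
      ... | yes Zu | yes Zu′ =
        let _ , w₁ , in₁  = reach Du Zu
            _ , w₂ , in₂  = reach Du′ Zu′
            _ , w₁′ , sub = walk-reverse E-sym w₁
            p , w , split = walk-trans w₁′ w₂
        in  p , w , λ x∈ → ψ-in ([ (λ x∈₁ → proj₁ (in₁ (sub x∈₁))) , (λ x∈₂ → proj₁ (in₂ x∈₂)) ]′ (split x∈))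
      ... | yes Zu | no ¬Zu′ = ⊥-elim (¬Zu′ (subst Z eq Z-v))
      ... | no ¬Zu | yes Zu′ = ⊥-elim (¬Zu (subst Z (≡.sym eq) Z-v))
      ... | no ¬Zu | no ¬Zu′ =
        let p , w , lab = connected Du Du′ eq in p , w , λ x∈ → trans (cong ψ (lab x∈)) (ψ-out ¬Zu)

      hit′ : V → List V
      hit′ a with a ≟ v
      ... | yes _ = S
      ... | no _  = hit a

      |hit′|≤s : ∀ a → length (hit′ a) ≤ s
      |hit′|≤s a with a ≟ v
      ... | yes _ = proj₁ (proj₂ (cut v Dv))
      ... | no _  = |hit|≤s a

      hits′ : ∀ {i x} → x ∈ path P i → ∃ λ y → y ∈ path P i × y ∈ hit′ (φ′ x)
      hits′ {i} {x} x∈ with φ′ x ≟ v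
      ... | yes eq =
        let p , w , av = reach (P⊆Dom x∈) (inside eq)
        in  proj₂ (proj₂ (proj₂ (cut v Dv)))
              (walk-map (λ _ y∈ e → e , proj₂ (av y∈) (proj₂ (dom e))) w) x∈
      ... | no ne = let y , y∈ , y∈hit = hits x∈ in y , y∈ , subst (λ a → y ∈ hit a) (≡.sym (ψ-out (outside ne))) y∈hit

      small-v : Small φ′ v
      small-v = T , ℕ.≤-trans (ℕ.≤-reflexive (length-map φ S)) (proj₁ (proj₂ (cut v Dv))) , nbs
        where
        nbs : ∀ {u u′} → E u u′ → φ′ u ≡ v → φ′ u′ ≢ v → φ′ u′ ∈ T
        nbs {u} {u′} e eq ne with φ u′ ∈? T
        ... | yes φu′∈T = subst (_∈ T) (≡.sym (ψ-out (outside ne))) φu′∈T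
        ... | no φu′∉T with q , w ← inside eq =
          ⊥-elim (outside ne (_ , walk-join w ((different , u , u′ , e , refl , refl) , φu′∉T) stop))
          where
          different : φ u ≢ φ u′
          different same = outside ne (subst Z same (inside eq))

      fibre : ∀ {a u} → a ≢ v → φ′ u ≡ a → φ u ≡ a × ¬ Z (φ u)
      fibre {a} {u} a≢v eq with Z? (φ u)
      ... | yes _ = ⊥-elim (a≢v (≡.sym eq))
      ... | no ¬Z = eq , ¬Z

      -- Merging other labels can only identify neighbours of `a`, never add to them.
      small′ : ∀ {a} → a ≢ v → Small φ a → Small φ′ a
      small′ {a} a≢v (N , |N|≤s , nbs) = map ψ N , ℕ.≤-trans (ℕ.≤-reflexive (length-map ψ N)) |N|≤s ,
        λ {u} {u′} e eq ne →
          let φu≡a , ¬Zu = fibre a≢v eq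
          in  M.∈-map⁺ ψ (nbs e φu≡a (λ φu′≡a → ne (trans (cong ψ (trans φu′≡a (≡.sym φu≡a))) eq)))

      result : Partial (v ∷ L)
      result = record
        { φ         = φ′
        ; connected = connected′
        ; hit       = hit′
        ; |hit|≤s   = |hit′|≤s
        ; hits      = hits′
        ; small     = small″
        ; status    = status′
        }
        where
        small″ : ∀ {a} → a ∈ v ∷ L → Small φ′ a
        small″ {a} a∈ with a ≟ v
        small″ a∈ | yes refl = small-v
        small″ (here eq) | no a≢v = ⊥-elim (a≢v eq)
        small″ (there a∈) | no a≢v = small′ a≢v (small a∈)
        status′ : ∀ a → Small φ′ a ⊎ Trivial φ′ a
        status′ a with a ≟ v
        ... | yes refl = inj₁ small-v
        ... | no a≢v with status a
        ...   | inj₁ sm = inj₁ (small′ a≢v sm)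
        ...   | inj₂ tr = inj₂ λ Du eq → tr Du (proj₁ (fibre a≢v eq))

    contract : ∀ L → Partial L
    contract [] = record
      { φ         = id
      ; connected = λ { _ _ refl → _ , stop , λ { (here refl) → refl } }
      ; hit       = λ a → a ∷ []
      ; |hit|≤s   = λ _ → 1≤s
      ; hits      = λ x∈ → _ , x∈ , here refl
      ; small     = λ ()
      ; status    = λ a → inj₂ λ _ eq → eq
      }
    contract (v ∷ L) with C ← contract L with Partial.status C v
    ... | inj₁ sm = mark C sm
    ... | inj₂ triv with Dom? v | Partial.φ C v ≟ v
    ...   | yes Dv | yes φv = Contract.result C Dv triv φv
    -- In this case and the next the fibre of `v` contains no vertex of `Dom`, so it has no
    -- neighbours.
    ...   | no ¬Dv | _ = mark C ([] , z≤n , λ e eq _ → ⊥-elim (¬Dv (subst Dom (triv (proj₁ (dom e)) eq) (proj₁ (dom e)))))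
    ...   | yes _ | no φv≢v = mark C ([] , z≤n , λ e eq _ → ⊥-elim (φv≢v (trans (cong (Partial.φ C) (≡.sym (triv (proj₁ (dom e)) eq))) eq)))

    abstract
      contraction : Partial elements
      contraction = contract elements

    open Partial contraction
    private module Quo = Quotients fin fin E? φ

    quotient-sym : Symmetric (Quotient E φ)
    quotient-sym (ne , u , v , e , eq , eq′) = (λ eq″ → ne (≡.sym eq″)) , v , u , E-sym e , eq′ , eq

    nb : V → List V
    nb a = proj₁ (small (complete a))

    nb-complete : ∀ {a b} → Quotient E φ a b → b ∈ nb a
    nb-complete (ne , u , u′ , e , refl , refl) = proj₂ (proj₂ (small (complete _))) e refl (λ eq → ne (≡.sym eq))

    projected : ∀ {l} → Family E X Y l → Family (Quotient E φ) (Quo.Image X) (Quo.Image Y) l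
    projected R = record
      { path  = λ i → proj₁ (Quo.project (walk R i))
      ; src   = λ i → φ (src R i)
      ; dst   = λ i → φ (dst R i)
      ; walk  = λ i → proj₁ (proj₂ (Quo.project (walk R i)))
      ; src∈X = λ i → _ , src∈X R i , refl
      ; dst∈Y = λ i → _ , dst∈Y R i , refl
      }

    projected-disjoint : ∀ {l} (R : Family E X Y l) → LabelDisjoint φ R → Disjoint (projected R)
    projected-disjoint R labels {i} {j} a∈i a∈j =
      let _ , x∈ , eq  = proj₂ (proj₂ (Quo.project (walk R i))) a∈i
          _ , y∈ , eq′ = proj₂ (proj₂ (Quo.project (walk R j))) a∈j
      in  labels x∈ y∈ (trans eq (≡.sym eq′))

    abstract
      quotient-paths : ∀ {l} (R : Family E X Y l) → LabelDisjoint φ R → ∃ λ m → l ≤ degreeFactor s * m ×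
        Σ (Family (Quotient E φ) (Quo.Image X) (Quo.Image Y) m) λ Q → Disjoint Q × NonAdjacent Q
      quotient-paths R labels = BoundedDegree.nonadjacent-paths fin Quo.quotient? quotient-sym (λ (ne , _) → ne refl)
        s nb (λ a → proj₁ (proj₂ (small (complete a)))) nb-complete (projected R) (projected-disjoint R labels)

    lift-nonadjacent : ∀ {m} → (∀ {v} → X v → Dom v) → (∀ {v} → Y v → Dom v) →
      (Q : Family (Quotient E φ) (Quo.Image X) (Quo.Image Y) m) → Disjoint Q → NonAdjacent Q →
      Σ (Family E X Y m) λ Q → Disjoint Q × NonAdjacent Q
    lift-nonadjacent X⊆ Y⊆ Q disj nonadj with Q′ , labels ← Quo.lift-family dom connected X⊆ Y⊆ Q =
      Q′ , (λ {i} {j} x∈ x∈′ → disj (labels i x∈) (labels j x∈′)) , nonadj′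
      where
      nonadj′ : NonAdjacent Q′
      nonadj′ {i} {j} {x} {y} x∈ y∈ e with φ x ≟ φ y
      ... | yes eq = disj (labels i x∈) (subst (_∈ path Q j) (≡.sym eq) (labels j y∈))
      ... | no ne  = nonadj (labels i x∈) (labels j y∈) (ne , x , y , e , refl , refl)

    nonadjacent-via-contraction : Decidable₁ X → Decidable₁ Y → (∀ {v} → X v → Dom v) → (∀ {v} → Y v → Dom v) → Disjoint P →
      ∃ λ m → k ≤ s * (degreeFactor s * m) × Σ (Family E X Y m) λ Q → Disjoint Q × NonAdjacent Q
    nonadjacent-via-contraction X? Y? X⊆ Y⊆ disj =
      let l , k≤ , R , labels = Thinning.thin fin fin E? φ dom connected X? Y? X⊆ Y⊆ 1≤s P disj hit |hit|≤s hits
          m , l≤ , Q , Q-disj , Q-nonadj = quotient-paths R labels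
      in  m , ℕ.≤-trans k≤ (ℕ.*-monoʳ-≤ s l≤) , lift-nonadjacent X⊆ Y⊆ Q Q-disj Q-nonadj

  -- Independent sets or clique minors

  module DuchetMeyniel {R : Set} (_≟_ : DecidableEquality R) {H : R → R → Set} (H? : Decidable H) (H-sym : Symmetric H) where
    open import Data.List.Membership.DecPropositional _≟_ using (_∈?_)
    import Data.List.Relation.Unary.Unique.Propositional.Properties as Unique

    Within : List R → R → R → Set
    Within D i j = ∃ λ p → Walk H i j p × (∀ {x} → x ∈ p → x ∈ D)

    record Independent (W : List R) : Set where
      field
        set         : List R
        set⊆        : ∀ {x} → x ∈ set → x ∈ W
        set-unique  : Unique set
        independent : ∀ {x y} → x ∈ set → y ∈ set → ¬ H x y ⊎ x ≡ y

    record CliqueModel (W : List R) (t : ℕ) : Set where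
      field
        branch       : Fin t → List R
        branch⊆      : ∀ {j x} → x ∈ branch j → x ∈ W
        member       : ∀ j → ∃ λ x → x ∈ branch j
        disjoint     : ∀ {i j x} → x ∈ branch i → x ∈ branch j → i ≡ j
        connected    : ∀ {j x y} → x ∈ branch j → y ∈ branch j → Within (branch j) x y
        adjacent     : ∀ {i j} → i ≢ j → ∃ λ x → ∃ λ y → x ∈ branch i × y ∈ branch j × H x y

    model-⊆ : ∀ {W W′ t} → (∀ {x} → x ∈ W → x ∈ W′) → CliqueModel W t → CliqueModel W′ t
    model-⊆ sub B = record { branch = branch ; branch⊆ = sub ∘ branch⊆ ; member = member
      ; disjoint = disjoint ; connected = connected ; adjacent = adjacent }
      where open CliqueModel B

    Touches : List R → R → Set
    Touches D x = Any (H x) D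

    touches? : ∀ D → Decidable₁ (Touches D)
    touches? D x = any? (H? x) D

    -- A connected set of which at least half is independent. `D` can serve as a branch set, `I` as
    -- an independent set that pays for all of `D`.
    record Core (W : List R) (root : R) : Set where
      field
        D I         : List R
        D⊆          : ∀ {x} → x ∈ D → x ∈ W
        D-unique    : Unique D
        root∈       : root ∈ D
        I⊆          : ∀ {x} → x ∈ I → x ∈ D
        I-unique    : Unique I
        independent : ∀ {x y} → x ∈ I → y ∈ I → ¬ H x y ⊎ x ≡ y
        |D|≤        : length D ≤ 2 * length I
        reach       : ∀ {x} → x ∈ D → Within D root x

    -- The point of exhausting distance two: what lies beyond the neighbours of `D` is not adjacent
    -- to these neighbours, so independent sets of both parts can be united.
    Stuck : List R → List R → Set
    Stuck W D = ∀ {x n} → x ∈ W → n ∈ W → Touches D n → H x n → x ∈ D ⊎ Touches D x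

    -- Each step adds a vertex at distance two from D, together with a common neighbour.
    grow : ∀ {W root} fuel → (C : Core W root) → length W < fuel + length (Core.D C) →
      Σ (Core W root) λ C → Stuck W (Core.D C)
    grow zero C bound = ⊥-elim (ℕ.<⇒≱ bound (Unique-⊆⇒length≤ (Core.D-unique C) (Core.D⊆ C)))
    grow {W} {root} (suc fuel) C bound
      with any? (λ x → ¬? (x ∈? D) ×-dec ¬? (touches? D x) ×-dec any? (λ n → touches? D n ×-dec H? x n) W) W
      where open Core C
    ... | no none = C , stuck
      where
      open Core C
      stuck : Stuck W D
      stuck {x} x∈ n∈ tn h with x ∈? D | touches? D x
      ... | yes x∈D | _      = inj₁ x∈D
      ... | no _    | yes tx = inj₂ tx
      ... | no x∉D  | no ¬tx = ⊥-elim (none (Any.map (λ { refl → x∉D , ¬tx , Any.map (λ { refl → tn , h }) n∈ }) x∈))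
    ... | yes found with x , x∈W , x∉D , ¬tx , found′ ← find found
      with n , n∈W , tn , h ← find found′ = grow fuel C′ bound′
      where
      open Core C
      d = proj₁ (find tn)
      d∈D : d ∈ D
      d∈D = proj₁ (proj₂ (find tn))
      n~d : H n d
      n~d = proj₂ (proj₂ (find tn))
      n∉D : n ∉ D
      n∉D n∈D = ¬tx (Any.map (λ { refl → h }) n∈D)
      x≢n : x ≢ n
      x≢n refl = ¬tx tn
      D′ = x ∷ n ∷ D
      weaken : ∀ {i j} → Within D i j → Within D′ i j
      weaken (p , w , sub) = p , w , there ∘ there ∘ sub
      to-n : Within D′ root n
      to-n = let p , w , sub = reach d∈D
             in  p ++ n ∷ [] , walk-join w (H-sym n~d) stop ,
                 λ y∈ → [ there ∘ there ∘ sub , (λ { (here refl) → there (here refl) }) ]′ (M.∈-++⁻ p y∈)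
      to-x : Within D′ root x
      to-x = let p , w , sub = to-n
             in  p ++ x ∷ [] , walk-join w (H-sym h) stop ,
                 λ y∈ → [ sub , (λ { (here refl) → here refl }) ]′ (M.∈-++⁻ p y∈)
      C′ : Core W root
      C′ = record
        { D = D′
        ; I = x ∷ I
        ; D⊆ = λ { (here refl) → x∈W ; (there (here refl)) → n∈W ; (there (there y∈)) → D⊆ y∈ }
        ; D-unique = (x≢n ∷ All.tabulate (λ { y∈ refl → x∉D y∈ })) AllPairs.∷ All.tabulate (λ { y∈ refl → n∉D y∈ }) AllPairs.∷ D-unique
        ; root∈ = there (there root∈)
        ; I⊆ = λ { (here refl) → here refl ; (there y∈) → there (there (I⊆ y∈)) }
        ; I-unique = All.tabulate (λ { y∈ refl → x∉D (I⊆ y∈) }) AllPairs.∷ I-unique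
        ; independent = λ { (here refl) (here refl) → inj₂ refl
                          ; (here refl) (there y∈) → inj₁ λ h′ → ¬tx (Any.map (λ { refl → h′ }) (I⊆ y∈))
                          ; (there y∈) (here refl) → inj₁ λ h′ → ¬tx (Any.map (λ { refl → H-sym h′ }) (I⊆ y∈))
                          ; (there y∈) (there z∈) → independent y∈ z∈ }
        ; |D|≤ = ℕ.≤-trans (s≤s (s≤s |D|≤)) (ℕ.≤-reflexive (≡.sym (ℕ.*-suc 2 (length I))))
        ; reach = λ { (here refl) → to-x ; (there (here refl)) → to-n ; (there (there y∈)) → weaken (reach y∈) }
        }
      bound′ : length W < fuel + suc (suc (length D))
      bound′ = ℕ.≤-trans bound (ℕ.≤-trans (ℕ.≤-reflexive (≡.sym (ℕ.+-suc fuel (length D)))) (ℕ.+-monoʳ-≤ fuel (ℕ.n≤1+n _)))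

    dominating : ∀ {W root} → root ∈ W → Σ (Core W root) λ C → Stuck W (Core.D C)
    dominating {W} {root} root∈W = grow (length W) (record
      { D = root ∷ [] ; I = root ∷ []
      ; D⊆ = λ { (here refl) → root∈W }
      ; D-unique = [] AllPairs.∷ AllPairs.[]
      ; root∈ = here refl
      ; I⊆ = id
      ; I-unique = [] AllPairs.∷ AllPairs.[]
      ; independent = λ { (here refl) (here refl) → inj₂ refl }
      ; |D|≤ = s≤s z≤n
      ; reach = λ { (here refl) → _ , stop , id }
      }) (ℕ.≤-reflexive (ℕ.+-comm 1 (length W)))

    Outcome : ℕ → List R → Set
    Outcome t W = (Σ (Independent W) λ I → length W ≤ 2 * t * length (Independent.set I)) ⊎ CliqueModel W t

    -- W falls into D, the part N dominated by D, and the rest, which is not adjacent to D ∪ N.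
    module Step (t : ℕ) (by-t : ∀ W → Unique W → Outcome t W) {W : List R} (W-unique : Unique W) {root : R} (root∈W : root ∈ W)
      (by-size : ∀ W′ → length W′ < length W → Unique W′ → Outcome (suc t) W′) where
      abstract
        core : Σ (Core W root) λ C → Stuck W (Core.D C)
        core = dominating root∈W
      open Core (proj₁ core)
      stuck = proj₂ core

      N? : Decidable₁ (λ x → x ∉ D × Touches D x)
      N? x = ¬? (x ∈? D) ×-dec touches? D x
      rest? : Decidable₁ (λ x → x ∉ D × ¬ Touches D x)
      rest? x = ¬? (x ∈? D) ×-dec ¬? (touches? D x)
      N rest : List R
      N = filter N? W
      rest = filter rest? W

      N⁻ : ∀ {x} → x ∈ N → x ∈ W × x ∉ D × Touches D x
      N⁻ = M.∈-filter⁻ N? {xs = W}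
      rest⁻ : ∀ {x} → x ∈ rest → x ∈ W × x ∉ D × ¬ Touches D x
      rest⁻ = M.∈-filter⁻ rest? {xs = W}

      |W|≤ : length W ≤ length D + (length N + length rest)
      |W|≤ = ℕ.≤-trans (Unique-⊆⇒length≤ W-unique cover)
        (ℕ.≤-reflexive (trans (length-++ D) (cong (length D +_) (length-++ N))))
        where
        cover : ∀ {x} → x ∈ W → x ∈ D ++ N ++ rest
        cover {x} x∈ with x ∈? D | touches? D x
        ... | yes x∈D | _ = M.∈-++⁺ˡ x∈D
        ... | no x∉D | yes tx = M.∈-++⁺ʳ D (M.∈-++⁺ˡ (M.∈-filter⁺ N? x∈ (x∉D , tx)))
        ... | no x∉D | no ¬tx = M.∈-++⁺ʳ D (M.∈-++⁺ʳ N (M.∈-filter⁺ rest? x∈ (x∉D , ¬tx)))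

      rest-smaller : length rest < length W
      rest-smaller = Unique-⊆⇒length≤
        (All.tabulate (λ { x∈ refl → proj₁ (proj₂ (rest⁻ x∈)) root∈ }) AllPairs.∷ Unique.filter⁺ rest? W-unique)
        (λ { (here refl) → root∈W ; (there x∈) → proj₁ (rest⁻ x∈) })

      add-branch : CliqueModel N t → CliqueModel W (suc t)
      add-branch B = record
        { branch = branch′
        ; branch⊆ = λ { {zero} x∈ → D⊆ x∈ ; {suc j} x∈ → proj₁ (N⁻ (branch⊆ x∈)) }
        ; member = λ { zero → root , root∈ ; (suc j) → member j }
        ; disjoint = λ { {zero} {zero} _ _ → refl
                       ; {zero} {suc j} x∈ x∈′ → ⊥-elim (proj₁ (proj₂ (N⁻ (branch⊆ x∈′))) x∈)
                       ; {suc i} {zero} x∈ x∈′ → ⊥-elim (proj₁ (proj₂ (N⁻ (branch⊆ x∈))) x∈′)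
                       ; {suc i} {suc j} x∈ x∈′ → cong suc (disjoint x∈ x∈′) }
        ; connected = λ { {zero} x∈ y∈ →
                            let _ , wx , sx = reach x∈
                                _ , wy , sy = reach y∈
                                _ , wx′ , sx′ = walk-reverse H-sym wx
                                p , w , split = walk-trans wx′ wy
                            in  p , w , λ z∈ → [ sx ∘ sx′ , sy ]′ (split z∈)
                        ; {suc j} x∈ y∈ → connected x∈ y∈ }
        ; adjacent = adjacent′
        }
        where
        open CliqueModel B
        branch′ : Fin (suc t) → List R
        branch′ zero = D
        branch′ (suc j) = branch j
        to-D : ∀ j → ∃ λ x → ∃ λ y → x ∈ branch j × y ∈ D × H x y
        to-D j = let x , x∈ = member j
                     y , y∈ , h = find (proj₂ (proj₂ (N⁻ (branch⊆ x∈))))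
                 in  x , y , x∈ , y∈ , h
        adjacent′ : ∀ {i j} → i ≢ j → ∃ λ x → ∃ λ y → x ∈ branch′ i × y ∈ branch′ j × H x y
        adjacent′ {zero} {zero} ne = ⊥-elim (ne refl)
        adjacent′ {zero} {suc j} ne = let x , y , x∈ , y∈ , h = to-D j in y , x , y∈ , x∈ , H-sym h
        adjacent′ {suc i} {zero} ne = to-D i
        adjacent′ {suc i} {suc j} ne = adjacent (ne ∘ cong suc)

      InBlock : Independent W → Set
      InBlock I = ∀ {x} → x ∈ Independent.set I → x ∈ D ⊎ Touches D x

      -- The larger of `I` and `J` pays for both parts, twice its size for `D` and 2 t times its
      -- size for `N`. This is where the factor passes from 2 t to 2 (t + 1).
      block : (J : Independent N) → length N ≤ 2 * t * length (Independent.set J) →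
        Σ (Independent W) λ K → length D + length N ≤ 2 * suc t * length (Independent.set K) × InBlock K
      block J |N|≤ with ℕ.≤-total (length I) (length (Independent.set J))
      ... | inj₁ I≤J = record
          { set = set ; set⊆ = proj₁ ∘ N⁻ ∘ set⊆ ; set-unique = set-unique ; independent = Independent.independent J } ,
          (begin
            length D + length N                              ≤⟨ ℕ.+-mono-≤ (ℕ.≤-trans |D|≤ (ℕ.*-monoʳ-≤ 2 I≤J)) |N|≤ ⟩
            2 * length set + 2 * t * length set              ≡⟨ ℕ.*-distribʳ-+ (length set) 2 (2 * t) ⟨
            (2 + 2 * t) * length set                         ≡⟨ cong (_* length set) (ℕ.*-suc 2 t) ⟨
            2 * suc t * length set                           ∎) ,
          λ x∈ → inj₂ (proj₂ (proj₂ (N⁻ (set⊆ x∈))))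
        where
        open Independent J using (set; set⊆; set-unique)
        open ℕ.≤-Reasoning
      ... | inj₂ J≤I = record
          { set = I ; set⊆ = D⊆ ∘ I⊆ ; set-unique = I-unique ; independent = independent } ,
          (begin
            length D + length N                              ≤⟨ ℕ.+-mono-≤ |D|≤ (ℕ.≤-trans |N|≤ (ℕ.*-monoʳ-≤ (2 * t) J≤I)) ⟩
            2 * length I + 2 * t * length I                  ≡⟨ ℕ.*-distribʳ-+ (length I) 2 (2 * t) ⟨
            (2 + 2 * t) * length I                           ≡⟨ cong (_* length I) (ℕ.*-suc 2 t) ⟨
            2 * suc t * length I                             ∎) ,
          inj₁ ∘ I⊆
        where open ℕ.≤-Reasoning

      unite : (K : Independent W) → length D + length N ≤ 2 * suc t * length (Independent.set K) → InBlock K →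
        (L : Independent rest) → length rest ≤ 2 * suc t * length (Independent.set L) → Outcome (suc t) W
      unite K |DN|≤ K⊆ L |rest|≤ = inj₁ (record
          { set = K.set ++ L.set
          ; set⊆ = λ x∈ → [ K.set⊆ , proj₁ ∘ rest⁻ ∘ L.set⊆ ]′ (M.∈-++⁻ K.set x∈)
          ; set-unique = Unique.++⁺ K.set-unique L.set-unique (λ (x∈K , x∈L) → apart x∈L (K⊆ x∈K))
          ; independent = λ x∈ y∈ → pair (M.∈-++⁻ K.set x∈) (M.∈-++⁻ K.set y∈)
          } , (begin
            length W                                                       ≤⟨ |W|≤ ⟩
            length D + (length N + length rest)                            ≡⟨ ℕ.+-assoc (length D) (length N) (length rest) ⟨
            length D + length N + length rest                              ≤⟨ ℕ.+-mono-≤ |DN|≤ |rest|≤ ⟩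
            2 * suc t * length K.set + 2 * suc t * length L.set            ≡⟨ ℕ.*-distribˡ-+ (2 * suc t) (length K.set) (length L.set) ⟨
            2 * suc t * (length K.set + length L.set)                      ≡⟨ cong (2 * suc t *_) (length-++ K.set) ⟨
            2 * suc t * length (K.set ++ L.set)                            ∎))
        where
        module K = Independent K
        module L = Independent L
        open ℕ.≤-Reasoning
        apart : ∀ {x} → x ∈ L.set → ¬ (x ∈ D ⊎ Touches D x)
        apart x∈L (inj₁ x∈D) = proj₁ (proj₂ (rest⁻ (L.set⊆ x∈L))) x∈D
        apart x∈L (inj₂ tx)  = proj₂ (proj₂ (rest⁻ (L.set⊆ x∈L))) tx
        across : ∀ {x y} → x ∈ K.set → y ∈ L.set → ¬ H y x
        across x∈K y∈L h with K⊆ x∈K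
        ... | inj₁ x∈D = apart y∈L (inj₂ (Any.map (λ { refl → h }) x∈D))
        ... | inj₂ tx = apart y∈L (stuck (proj₁ (rest⁻ (L.set⊆ y∈L))) (K.set⊆ x∈K) tx h)
        pair : ∀ {x y} → x ∈ K.set ⊎ x ∈ L.set → y ∈ K.set ⊎ y ∈ L.set → ¬ H x y ⊎ x ≡ y
        pair (inj₁ x∈) (inj₁ y∈) = K.independent x∈ y∈
        pair (inj₁ x∈) (inj₂ y∈) = inj₁ (across x∈ y∈ ∘ H-sym)
        pair (inj₂ x∈) (inj₁ y∈) = inj₁ (across y∈ x∈)
        pair (inj₂ x∈) (inj₂ y∈) = L.independent x∈ y∈

      outcome : Outcome (suc t) W
      outcome with by-t N (Unique.filter⁺ N? W-unique)
      ... | inj₂ B = inj₂ (add-branch B)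
      ... | inj₁ (J , |N|≤) with by-size rest rest-smaller (Unique.filter⁺ rest? W-unique)
      ...   | inj₂ B = inj₂ (model-⊆ (proj₁ ∘ rest⁻) B)
      ...   | inj₁ (L , |rest|≤) with K , |DN|≤ , K⊆ ← block J |N|≤ = unite K |DN|≤ K⊆ L |rest|≤

    duchet-meyniel : ∀ t W → Unique W → Outcome t W
    duchet-meyniel zero W un = inj₂ (record
      { branch = λ () ; branch⊆ = λ { {()} } ; member = λ () ; disjoint = λ { {()} } ; connected = λ { {()} } ; adjacent = λ { {()} } })
    duchet-meyniel (suc t) W un = by-fuel (length W) W ℕ.≤-refl un
      where
      by-fuel : ∀ fuel W → length W ≤ fuel → Unique W → Outcome (suc t) W
      by-fuel _ [] _ un = inj₁ (record
        { set = [] ; set⊆ = λ () ; set-unique = AllPairs.[] ; independent = λ () } , z≤n)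
      by-fuel (suc fuel) W@(_ ∷ _) |W|≤ un =
        Step.outcome t (duchet-meyniel t) un (here refl)
          (λ W′ smaller un′ → by-fuel fuel W′ (ℕ.≤-pred (ℕ.≤-trans smaller |W|≤)) un′)

  -- Linking free vertices through a clique minor

  ⊎-finite : ∀ {A B : Set} → Finite A → Finite B → Finite (A ⊎ B)
  ⊎-finite A B = record
    { _≟_      = ≡-dec A._≟_ B._≟_
    ; elements = map inj₁ A.elements ++ map inj₂ B.elements
    ; complete = λ { (inj₁ a) → M.∈-++⁺ˡ (M.∈-map⁺ inj₁ (A.complete a))
                   ; (inj₂ b) → M.∈-++⁺ʳ (map inj₁ A.elements) (M.∈-map⁺ inj₂ (B.complete b)) }
    }
    where
    module A = Finite A
    module B = Finite B

  Fin-finite : ∀ n → Finite (Fin n)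
  Fin-finite n = record { _≟_ = F._≟_ ; elements = allFin n ; complete = M.∈-allFin }

  -- At most r branch sets contain a terminal, each of the r² rounds drops fewer than r² further
  -- ones, and more than r² have to be left at the end.
  branchCount : ℕ → ℕ
  branchCount r = r + (suc (r * r) + r * r * (r * r))

  module Linking {V : Set} (fin : Finite V) {E : V → V → Set} (E? : Decidable E) (E-sym : Symmetric E)
    {r : ℕ} (v : Fin r → V)
    (B : Fin (branchCount r) → V → Set) (B? : ∀ j → Decidable₁ (B j))
    (member : ∀ j → ∃ (B j))
    (B-disjoint : ∀ {i j x} → B i x → B j x → i ≡ j)
    (B-connected : ∀ {j x y} → B j x → B j y → ∃ λ p → Walk E x y p × (∀ {u} → u ∈ p → B j u))
    (B-adjacent : ∀ {i j} → i ≢ j → ∃ λ x → ∃ λ y → B i x × B j y × E x y)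
    (free : ∀ i S → length S ≤ r + r * r → v i ∉ S → ∀ j → (∀ {x} → B j x → x ∉ S) →
      ¬ (∀ {x p} → B j x → ¬ Walk (Entering E (_∈ S)) (v i) x p)) where
    open Finite fin

    z = r * r
    V⁺ = Fin z ⊎ V
    fin⁺ = ⊎-finite (Fin-finite z) fin
    open Finite fin⁺ using () renaming (_≟_ to _≟⁺_)
    open import Data.List.Membership.DecPropositional _≟⁺_ using () renaming (_∈?_ to _∈⁺?_)
    open import Data.List.Membership.DecPropositional (F._≟_ {branchCount r}) using (_∈?_)
    import Data.List.Relation.Unary.Unique.Propositional.Properties as Unique

    owner : Fin z → V
    owner c = v (proj₁ (remQuot r c))

    Terminal : V → Set
    Terminal u = ∃ λ i → v i ≡ u

    terminal? : Decidable₁ Terminal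
    terminal? u = F.any? λ i → v i ≟ u

    -- Each terminal v i is replaced by r copies, one for each path that has to leave it.
    E⁺ : V⁺ → V⁺ → Set
    E⁺ (inj₁ c) (inj₁ _) = ⊥
    E⁺ (inj₁ c) (inj₂ u) = E (owner c) u × ¬ Terminal u
    E⁺ (inj₂ u) (inj₁ _) = ⊥
    E⁺ (inj₂ u) (inj₂ w) = E u w × ¬ Terminal u × ¬ Terminal w

    E⁺? : Decidable E⁺
    E⁺? (inj₁ c) (inj₁ _) = no λ ()
    E⁺? (inj₁ c) (inj₂ u) = E? (owner c) u ×-dec ¬? (terminal? u)
    E⁺? (inj₂ u) (inj₁ _) = no λ ()
    E⁺? (inj₂ u) (inj₂ w) = E? u w ×-dec ¬? (terminal? u) ×-dec ¬? (terminal? w)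

    Source : V⁺ → Set
    Source x = ∃ λ c → x ≡ inj₁ c

    source? : Decidable₁ Source
    source? (inj₁ c) = yes (c , refl)
    source? (inj₂ u) = no λ ()

    Target : List (Fin (branchCount r)) → V⁺ → Set
    Target U x = ∃ λ u → ∃ λ j → x ≡ inj₂ u × j ∈ U × B j u

    target? : ∀ U → Decidable₁ (Target U)
    target? U (inj₁ c) = no λ ()
    target? U (inj₂ u) = map′ (λ (j , j∈ , b) → u , j , refl , j∈ , b) (λ { (_ , j , refl , j∈ , b) → j , j∈ , b })
      (F.any? λ j → (j ∈? U) ×-dec B? j u)

    rep : Fin (branchCount r) → V
    rep j = proj₁ (member j)

    Clean : Fin (branchCount r) → Set
    Clean j = ∀ {u} → B j u → ¬ Terminal u

    branch-walk : ∀ {j x y} → Clean j → B j x → B j y →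
      ∃ λ p → Walk E⁺ (inj₂ x) (inj₂ y) p × (∀ {w} → w ∈ p → ∃ λ u → w ≡ inj₂ u × B j u)
    branch-walk clean bx by with p , w , sub ← B-connected bx by = map inj₂ p , go w sub , λ w∈ →
        let u , u∈ , eq = M.∈-map⁻ inj₂ w∈ in u , eq , sub u∈
      where
      go : ∀ {x y p} → Walk E x y p → (∀ {u} → u ∈ p → B _ u) → Walk E⁺ (inj₂ x) (inj₂ y) (map inj₂ p)
      go stop sub = stop
      go (e ◂ w) sub = (e , clean (sub (here refl)) , clean (sub (there (walk-start w)))) ◂ go w (sub ∘ there)

    -- Only the branch sets in `U` are contracted. Those dropped in earlier rounds remain in the
    -- graph, and paths may use their vertices one by one.
    module Labels (U : List (Fin (branchCount r))) (clean : ∀ {j} → j ∈ U → Clean j) where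

      inBranch? : ∀ u → Dec (∃ λ j → j ∈ U × B j u)
      inBranch? u = F.any? λ j → (j ∈? U) ×-dec B? j u

      φ : V⁺ → V⁺
      φ (inj₁ c) = inj₁ c
      φ (inj₂ u) with inBranch? u
      ... | yes (j , _) = inj₂ (rep j)
      ... | no _        = inj₂ u

      φ-in : ∀ {j u} → j ∈ U → B j u → φ (inj₂ u) ≡ inj₂ (rep j)
      φ-in {j} {u} j∈ b with inBranch? u
      ... | yes (j′ , _ , b′) = cong (inj₂ ∘ rep) (B-disjoint b′ b)
      ... | no none = ⊥-elim (none (j , j∈ , b))

      φ-out : ∀ x → ¬ Target U x → φ x ≡ x
      φ-out (inj₁ c) ¬t = refl
      φ-out (inj₂ u) ¬t with inBranch? u
      ... | yes (j , j∈ , b) = ⊥-elim (¬t (u , j , refl , j∈ , b))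
      ... | no _ = refl

      φ-in⁻ : ∀ {x j} → j ∈ U → φ x ≡ inj₂ (rep j) → ∃ λ u → x ≡ inj₂ u × B j u
      φ-in⁻ {inj₂ u} {j} j∈ eq with inBranch? u
      ... | yes (j′ , _ , b) = u , refl , subst (λ i → B i u)
              (B-disjoint (proj₂ (member j′)) (subst (B j) (≡.sym (inj₂-injective eq)) (proj₂ (member j)))) b
      ... | no _ = u , refl , subst (B j) (≡.sym (inj₂-injective eq)) (proj₂ (member j))

      connected : ConnectedFibres E⁺ (λ _ → ⊤) φ
      connected {x} {y} _ _ eq with target? U x
      ... | yes (u , j , refl , j∈ , b)
        with w , refl , b′ ← φ-in⁻ {y} j∈ (trans (≡.sym eq) (φ-in j∈ b))
        with p , walk , sub ← branch-walk (clean j∈) b b′ =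
          p , walk , λ x∈ → case sub x∈ of λ { (_ , refl , b″) → trans (φ-in j∈ b″) (≡.sym (φ-in j∈ b)) }
      ... | no ¬tx with target? U y
      ...   | yes (w , j , refl , j∈ , b)
        with u , refl , b′ ← φ-in⁻ {x} j∈ (trans eq (φ-in j∈ b)) = ⊥-elim (¬tx (u , j , refl , j∈ , b′))
      ...   | no ¬ty with refl ← trans (≡.sym (φ-out x ¬tx)) (trans eq (φ-out y ¬ty)) = _ , stop , λ { (here refl) → refl }

      menger-labels : ∀ k → Σ (Family E⁺ Source (Target U) k) (LabelDisjoint φ) ⊎
        ∃ λ S → length S < k × Separates E⁺ Source (Target U) (λ x → φ x ∈ S)
      menger-labels k = Quotients.menger-quotient fin⁺ fin⁺ E⁺? φ (λ _ → tt , tt) connected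
        source? (target? U) (λ _ → tt) (λ _ → tt) k

    clean? : Decidable₁ Clean
    clean? j = map′ (λ none {u} b (i , eq) → none (i , subst (B j) (≡.sym eq) b)) (λ cl (i , b) → cl b (i , refl))
      (¬? (F.any? λ i → B? j (v i)))

    -- Since the walks stop at their first target, each of them meets a single branch set of `U`, at
    -- its end. `large` records that each round so far has cost at most `z` branch sets.
    record Stage (l : ℕ) : Set where
      field
        U         : List (Fin (branchCount r))
        U-unique  : Unique U
        clean     : ∀ {j} → j ∈ U → Clean j
        large     : suc z + z * z ≤ length U + l * z
        paths     : Family (Leaving E⁺ (Target U)) Source (Target U) l
        labels    : LabelDisjoint (Labels.φ U clean) paths

    U₀ : List (Fin (branchCount r))
    U₀ = filter clean? (allFin (branchCount r))

    U₀-large : suc z + z * z ≤ length U₀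
    U₀-large = ℕ.+-cancelˡ-≤ r _ _ (begin
      branchCount r                              ≡⟨ length-tabulate {n = branchCount r} id ⟨
      length (allFin (branchCount r))            ≤⟨ Unique-⊆⇒length≤ (Unique.allFin⁺ _) cover ⟩
      length (dirty ++ U₀)                       ≡⟨ length-++ dirty ⟩
      length dirty + length U₀                   ≤⟨ ℕ.+-monoˡ-≤ (length U₀) dirty≤ ⟩
      r + length U₀                              ∎)
      where
      open ℕ.≤-Reasoning
      dirty? = λ j → F.any? λ i → B? j (v i)
      dirty = filter dirty? (allFin (branchCount r))
      cover : ∀ {j} → j ∈ allFin (branchCount r) → j ∈ dirty ++ U₀
      cover {j} j∈ with dirty? j
      ... | yes d = M.∈-++⁺ˡ (M.∈-filter⁺ dirty? j∈ d)
      ... | no ¬d = M.∈-++⁺ʳ dirty (M.∈-filter⁺ clean? j∈ λ {u} b (i , eq) → ¬d (i , subst (B j) (≡.sym eq) b))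
      terminal-of : ∀ a → ∃ λ i → B (lookup dirty a) (v i)
      terminal-of a = proj₂ (M.∈-filter⁻ dirty? {xs = allFin (branchCount r)} (lookup∈ dirty a))
      dirty≤ : length dirty ≤ r
      dirty≤ = F.injective⇒≤ {f = λ a → proj₁ (terminal-of a)} λ {a} {b} eq →
        lookup-injective (Unique.filter⁺ dirty? (Unique.allFin⁺ _))
          (B-disjoint (proj₂ (terminal-of a)) (subst (λ i → B _ (v i)) (≡.sym eq) (proj₂ (terminal-of b))))

    first-stage : Stage 0
    first-stage = record
      { U = U₀ ; U-unique = Unique.filter⁺ clean? (Unique.allFin⁺ _)
      ; clean = λ j∈ → proj₂ (M.∈-filter⁻ clean? {xs = allFin (branchCount r)} j∈)
      ; large = ℕ.≤-trans U₀-large (ℕ.m≤m+n _ 0)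
      ; paths = record { path = λ () ; src = λ () ; dst = λ () ; walk = λ () ; src∈X = λ () ; dst∈Y = λ () }
      ; labels = λ { {()} }
      }

    vertices : List V⁺ → List V
    vertices = concatMap λ { (inj₁ _) → [] ; (inj₂ u) → u ∷ [] }

    ∈-vertices : ∀ {u xs} → inj₂ u ∈ xs → u ∈ vertices xs
    ∈-vertices {xs = xs} u∈ = M.∈-concatMap⁺ _ {xs = xs} (Any.map (λ { refl → here refl }) u∈)

    ∈-vertices⁻ : ∀ {u} xs → u ∈ vertices xs → inj₂ u ∈ xs
    ∈-vertices⁻ (inj₁ _ ∷ xs) u∈ = there (∈-vertices⁻ xs u∈)
    ∈-vertices⁻ (inj₂ _ ∷ xs) (here refl) = here refl
    ∈-vertices⁻ (inj₂ _ ∷ xs) (there u∈) = there (∈-vertices⁻ xs u∈)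

    -- Fewer than r² vertices miss a copy of some terminal `v i`. Together with the other terminals,
    -- and without `v i`, they number at most r + r² and would cut `v i` off from a branch set that
    -- they do not meet, against freeness.
    module Separator {j : Fin (branchCount r)} (clean : Clean j) (S : List V⁺) (|S|<z : length S < z)
      (misses : ∀ {u} → B j u → inj₂ u ∉ S)
      (sep : ∀ {c u p} → B j u → Walk E⁺ (inj₁ c) (inj₂ u) p → ∃ λ x → x ∈ p × x ∈ S) where

      abstract
        copy : ∃ λ c → inj₁ c ∉ S
        copy = fresh _≟⁺_ inj₁ inj₁-injective S |S|<z
      c = proj₁ copy
      i : Fin r
      i = proj₁ (remQuot r c)

      other? : Decidable₁ (_≢ v i)
      other? u = ¬? (u ≟ v i)

      S₀ : List V
      S₀ = filter other? (map v (allFin r) ++ vertices S)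

      |S₀|≤ : length S₀ ≤ r + z
      |S₀|≤ = begin
        length S₀                                               ≤⟨ length-filter other? (map v (allFin r) ++ vertices S) ⟩
        length (map v (allFin r) ++ vertices S)                 ≡⟨ length-++ (map v (allFin r)) ⟩
        length (map v (allFin r)) + length (vertices S)         ≡⟨ cong (_+ length (vertices S)) (trans (length-map v (allFin r)) (length-tabulate {n = r} id)) ⟩
        r + length (vertices S)                                 ≤⟨ ℕ.+-monoʳ-≤ r (length-concatMap-≤ _ 1 (λ { (inj₁ _) → z≤n ; (inj₂ _) → ℕ.≤-refl }) S) ⟩
        r + 1 * length S                                        ≡⟨ cong (r +_) (ℕ.*-identityˡ _) ⟩
        r + length S                                            ≤⟨ ℕ.+-monoʳ-≤ r (ℕ.<⇒≤ |S|<z) ⟩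
        r + z                                                   ∎
        where open ℕ.≤-Reasoning

      S₀⁻ : ∀ {u} → u ∈ S₀ → u ∈ map v (allFin r) ++ vertices S × u ≢ v i
      S₀⁻ = M.∈-filter⁻ other? {xs = map v (allFin r) ++ vertices S}

      unhit : ∀ {x} → B j x → x ∉ S₀
      unhit b x∈ with M.∈-++⁻ (map v (allFin r)) (proj₁ (S₀⁻ x∈))
      ... | inj₁ x∈v = let t , _ , eq = M.∈-map⁻ v x∈v in clean b (t , ≡.sym eq)
      ... | inj₂ x∈S = misses b (∈-vertices⁻ S x∈S)

      nonterminal : ∀ {u} → u ∉ S₀ → u ≢ v i → ¬ Terminal u
      nonterminal u∉ u≢ (t , refl) = u∉ (M.∈-filter⁺ other? (M.∈-++⁺ˡ (M.∈-map⁺ v (M.∈-allFin t))) u≢)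

      outside : ∀ {u} → u ∉ S₀ → u ≢ v i → inj₂ u ∉ S
      outside u∉ u≢ u∈S = u∉ (M.∈-filter⁺ other? (M.∈-++⁺ʳ (map v (allFin r)) (∈-vertices u∈S)) u≢)

      Good : V → V → Set
      Good = Entering (Entering E (_∈ S₀)) (_≡ v i)

      lift⁺ : ∀ {a b p} → ¬ Terminal a → Walk Good a b p → Walk E⁺ (inj₂ a) (inj₂ b) (map inj₂ p)
      lift⁺ ¬t stop = stop
      lift⁺ ¬t (((e , u∉) , u≢) ◂ w) = (e , ¬t , nonterminal u∉ u≢) ◂ lift⁺ (nonterminal u∉ u≢) w

      -- From its last visit to `v i` on, the walk meets no terminal, since the others belong to
      -- `S₀`. So this part is a walk in the split graph that starts at the missed copy.
      unreachable : ∀ {x p} → B j x → ¬ Walk (Entering E (_∈ S₀)) (v i) x p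
      unreachable b w with last-hit (_≟ v i) w refl
      ... | _ , _ , refl , stop , _ = clean b (i , refl)
      ... | _ , _ , refl , (((e , u∉) , u≢) ◂ w′) , _
        with sep b ((e , nonterminal u∉ u≢) ◂ lift⁺ (nonterminal u∉ u≢) w′)
      ...   | _ , here refl , c∈S = proj₂ copy c∈S
      ...   | _ , there y∈ , y∈S with y , y∈q , refl ← M.∈-map⁻ inj₂ y∈
        with good ← walk-all {U = λ y → y ∉ S₀ × y ≢ v i} (λ ((_ , y∉) , y≢) → y∉ , y≢) (u∉ , u≢) w′ y∈q
        = outside (proj₁ good) (proj₂ good) y∈S

      contradiction : ⊥
      contradiction = free i S₀ |S₀|≤ (λ v∈ → proj₂ (S₀⁻ v∈) refl) j unhit unreachable

    -- Drop the branch sets in which the l old paths end. A separator of size l in the new quotient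
    -- also separates in the old one, so it lies on the old paths and contains no remaining branch
    -- set: it is a separator of the graph itself, which freeness excludes.
    module Next {l : ℕ} (l<z : l < z) (st : Stage l) where
      open Stage st
      module Old = Labels U clean

      end : Fin l → Fin (branchCount r)
      end a = proj₁ (proj₂ (dst∈Y paths a))

      ends : List (Fin (branchCount r))
      ends = map end (allFin l)

      spare? : Decidable₁ (_∉ ends)
      spare? j = ¬? (j ∈? ends)

      U₁ : List (Fin (branchCount r))
      U₁ = filter spare? U

      U₁⁻ : ∀ {j} → j ∈ U₁ → j ∈ U × j ∉ ends
      U₁⁻ = M.∈-filter⁻ spare? {xs = U}

      U₁-unique : Unique U₁
      U₁-unique = Unique.filter⁺ spare? U-unique

      module New = Labels U₁ (λ j∈ → clean (proj₁ (U₁⁻ j∈)))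

      large₁ : suc z + z * z ≤ length U₁ + suc l * z
      large₁ = begin
        suc z + z * z                        ≤⟨ large ⟩
        length U + l * z                     ≤⟨ ℕ.+-monoˡ-≤ (l * z) (Unique-⊆⇒length≤ U-unique cover) ⟩
        length (U₁ ++ ends) + l * z          ≡⟨ cong (_+ l * z) (length-++ U₁) ⟩
        length U₁ + length ends + l * z      ≡⟨ cong (λ e → length U₁ + e + l * z) (trans (length-map end (allFin l)) (length-tabulate {n = l} id)) ⟩
        length U₁ + l + l * z                ≤⟨ ℕ.+-monoˡ-≤ (l * z) (ℕ.+-monoʳ-≤ (length U₁) (ℕ.<⇒≤ l<z)) ⟩
        length U₁ + z + l * z                ≡⟨ ℕ.+-assoc (length U₁) z (l * z) ⟩
        length U₁ + suc l * z                ∎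
        where
        open ℕ.≤-Reasoning
        cover : ∀ {j} → j ∈ U → j ∈ U₁ ++ ends
        cover {j} j∈ with j ∈? ends
        ... | yes j∈ends = M.∈-++⁺ʳ U₁ j∈ends
        ... | no j∉ends = M.∈-++⁺ˡ (M.∈-filter⁺ spare? j∈ j∉ends)

      l<|U₁| : l < length U₁
      l<|U₁| = ℕ.≤-trans (s≤s (ℕ.<⇒≤ l<z)) (ℕ.+-cancelʳ-≤ (z * z) _ _
        (ℕ.≤-trans large₁ (ℕ.+-monoʳ-≤ (length U₁) (ℕ.*-monoˡ-≤ z l<z))))

      -- The new labelling contracts fewer branch sets and is therefore finer than the old one; a
      -- separator of new labels can be read in old labels.
      φ-φ : ∀ x → Old.φ (New.φ x) ≡ Old.φ x
      φ-φ x with target? U₁ x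
      ... | no ¬t = cong Old.φ (New.φ-out x ¬t)
      ... | yes (u , j , refl , j∈ , b) = trans (cong Old.φ (New.φ-in j∈ b))
        (trans (Old.φ-in (proj₁ (U₁⁻ j∈)) (proj₂ (member j))) (≡.sym (Old.φ-in (proj₁ (U₁⁻ j∈)) b)))

      module Blocked (S : List V⁺) (|S|≤l : length S ≤ l)
        (sep : Separates E⁺ Source (Target U₁) (λ x → New.φ x ∈ S)) where

        abstract
          unblocked : ∃ λ a → inj₂ (rep (lookup U₁ a)) ∉ S
          unblocked = fresh _≟⁺_ (inj₂ ∘ rep ∘ lookup U₁)
            (λ {a} {b} eq → lookup-injective U₁-unique (B-disjoint (proj₂ (member (lookup U₁ a)))
              (subst (B _) (≡.sym (inj₂-injective eq)) (proj₂ (member (lookup U₁ b))))))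
            S (ℕ.≤-<-trans |S|≤l l<|U₁|)

        j = lookup U₁ (proj₁ unblocked)
        j∈U₁ : j ∈ U₁
        j∈U₁ = lookup∈ U₁ (proj₁ unblocked)

        S′ : List V⁺
        S′ = map Old.φ S

        to-S′ : ∀ x → New.φ x ∈ S → Old.φ x ∈ S′
        to-S′ x φx∈ = subst (_∈ S′) (φ-φ x) (M.∈-map⁺ Old.φ φx∈)

        -- The old path is prolonged through its last branch set and across an edge into the branch
        -- set `j`, whose label `S` misses. This walk meets `S`, but not at its final vertex in `j`.
        -- So it does on the old path, or in the branch set of its end, where all vertices share the
        -- old label of that end.
        met : ∀ a → ∃ λ x → x ∈ path paths a × Old.φ x ∈ S′
        met a with any? (λ x → Old.φ x ∈⁺? S′) (path paths a)
        ... | yes found = find found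
        ... | no none with u , e , eq , e∈ , bu ← dst∈Y paths a in eq-dst
          with x , y , bx , by , exy ← B-adjacent {e} {j} (λ { refl → proj₂ (U₁⁻ j∈U₁) (subst (λ d → proj₁ (proj₂ d) ∈ ends) eq-dst (M.∈-map⁺ end (M.∈-allFin a))) })
          with p , w , sub ← branch-walk (clean e∈) bu bx
          with q , w′ , split ← walk-trans (walk-map (λ _ _ → proj₁) (walk paths a))
            (subst (λ d → Walk E⁺ d (inj₂ y) (p ++ inj₂ y ∷ [])) (≡.sym eq)
              (walk-join w (exy , clean e∈ bx , clean (proj₁ (U₁⁻ j∈U₁)) by) stop))
          with s , s∈ , φs∈ ← sep (src∈X paths a) (y , j , refl , j∈U₁ , by) w′
          with split s∈
        ... | inj₁ s∈path = ⊥-elim (none (Any.map (λ { refl → to-S′ s φs∈ }) s∈path))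
        ... | inj₂ s∈rest with M.∈-++⁻ p s∈rest
        ...   | inj₂ (here refl) = ⊥-elim (proj₂ unblocked (subst (_∈ S) (New.φ-in j∈U₁ by) φs∈))
        ...   | inj₁ s∈p with w , refl , bw ← sub s∈p =
          ⊥-elim (none (Any.map (λ { refl → subst (_∈ S′)
            (trans (Old.φ-in e∈ bw) (trans (≡.sym (Old.φ-in e∈ bu)) (cong Old.φ (≡.sym eq)))) (to-S′ _ φs∈) }) (walk-end (walk paths a))))

        position : Fin l → Fin (length S′)
        position a = index (proj₂ (proj₂ (met a)))

        position-injective : ∀ {a b} → position a ≡ position b → a ≡ b
        position-injective {a} {b} eq = labels (proj₁ (proj₂ (met a))) (proj₁ (proj₂ (met b)))
          (index-injective (proj₂ (proj₂ (met a))) (proj₂ (proj₂ (met b))) eq)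

        -- The `l` old paths need `l` different elements of `S′`, which has no more than `l`; so
        -- none is left over.
        on-path : ∀ {s} → s ∈ S → ∃ λ a → ∃ λ x → x ∈ path paths a × Old.φ x ≡ Old.φ s
        on-path {s} s∈ with a , eq ← injective⇒surjective position position-injective
            (ℕ.≤-trans (ℕ.≤-reflexive (length-map Old.φ S)) |S|≤l) (index (M.∈-map⁺ Old.φ s∈)) =
          a , proj₁ (met a) , proj₁ (proj₂ (met a)) ,
          index-injective (proj₂ (proj₂ (met a))) (M.∈-map⁺ Old.φ s∈) eq

        -- Such a branch set would be met by an old path. Old paths meet targets only in their ends,
        -- and the branch sets of these ends have been dropped.
        no-target : ∀ {s} → s ∈ S → ¬ Target U₁ s
        no-target s∈ (u , i , refl , i∈ , b)
          with a , x , x∈ , eq ← on-path s∈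
          with u′ , refl , b′ ← Old.φ-in⁻ {x} (proj₁ (U₁⁻ i∈)) (trans eq (Old.φ-in (proj₁ (U₁⁻ i∈)) b))
          = proj₂ (U₁⁻ i∈) (subst (_∈ ends) (B-disjoint b-end b′) (M.∈-map⁺ end (M.∈-allFin a)))
          where
          at-end : inj₂ u′ ≡ dst paths a
          at-end = leaving-end (walk paths a) x∈ (u′ , i , refl , proj₁ (U₁⁻ i∈) , b′)
          b-end : B (end a) u′
          b-end = subst (B (end a)) (≡.sym (inj₂-injective (trans at-end (proj₁ (proj₂ (proj₂ (dst∈Y paths a)))))))
            (proj₂ (proj₂ (proj₂ (proj₂ (dst∈Y paths a)))))

        plain : ∀ x → New.φ x ∈ S → x ∈ S
        plain x φx∈ with target? U₁ x
        ... | no ¬t = subst (_∈ S) (New.φ-out x ¬t) φx∈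
        ... | yes (u , i , refl , i∈ , b) =
          ⊥-elim (no-target (subst (_∈ S) (New.φ-in i∈ b) φx∈) (rep i , i , refl , i∈ , proj₂ (member i)))

        contradiction : ⊥
        contradiction = Separator.contradiction (clean (proj₁ (U₁⁻ j∈U₁))) S (ℕ.≤-<-trans |S|≤l l<z)
          (λ {u} b u∈S → no-target u∈S (u , j , refl , j∈U₁ , b))
          λ {c} {u} b w →
            let x , x∈ , φx∈ = sep (c , refl) (u , j , refl , j∈U₁ , b) w
            in  x , x∈ , plain x φx∈

      next : Stage (suc l)
      next with New.menger-labels (suc l)
      ... | inj₂ (S , |S|<1+l , sep) = ⊥-elim (Blocked.contradiction S (ℕ.≤-pred |S|<1+l) sep)
      ... | inj₁ (Q , Q-labels) = record
        { U = U₁ ; U-unique = U₁-unique ; clean = λ j∈ → clean (proj₁ (U₁⁻ j∈)) ; large = large₁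
        ; paths = record
          { path  = λ a → proj₁ (proj₂ (hit a))
          ; src   = src Q
          ; dst   = λ a → proj₁ (hit a)
          ; walk  = λ a → proj₁ (proj₂ (proj₂ (proj₂ (hit a))))
          ; src∈X = src∈X Q
          ; dst∈Y = λ a → proj₁ (proj₂ (proj₂ (hit a)))
          }
        ; labels = λ {a} {b} x∈ y∈ → Q-labels (sub a x∈) (sub b y∈)
        }
        where
        hit = λ a → first-hit (target? U₁) (walk Q a) (dst∈Y Q a)
        sub : ∀ a {x} → x ∈ proj₁ (proj₂ (hit a)) → x ∈ path Q a
        sub a = proj₂ (proj₂ (proj₂ (proj₂ (hit a))))

    stage : ∀ l → l ≤ z → Stage l
    stage zero _ = first-stage
    stage (suc l) l<z = Next.next l<z (stage l (ℕ.<⇒≤ l<z))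

    abstract
      last-stage : Stage z
      last-stage = stage z ℕ.≤-refl

    open Stage last-stage
    open Labels U clean using (φ; φ-in)

    copy : Fin z → Fin z
    copy a = proj₁ (src∈X paths a)

    abstract
      -- The `z` paths start at different copies and there are only `z` copies, so each terminal has
      -- a path for every other one.
      from-copy : ∀ c → ∃ λ a → copy a ≡ c
      from-copy = injective⇒surjective copy injective ℕ.≤-refl
        where
        injective : ∀ {a b} → copy a ≡ copy b → a ≡ b
        injective {a} {b} eq = labels (walk-start (walk paths a)) (walk-start (walk paths b))
          (cong φ (trans (proj₂ (src∈X paths a)) (trans (cong inj₁ eq) (≡.sym (proj₂ (src∈X paths b))))))

    at : Fin r → Fin r → Fin z
    at i j = proj₁ (from-copy (combine i j))

    at-injective : ∀ {i j k l} → at i j ≡ at k l → i ≡ k × j ≡ l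
    at-injective {i} {j} {k} {l} eq = F.combine-injective i j k l
      (trans (≡.sym (proj₂ (from-copy (combine i j)))) (trans (cong copy eq) (proj₂ (from-copy (combine k l)))))

    -- The vertices reserved for the way from `v i` towards `v j`. Comparing labels rather than
    -- vertices includes the whole branch set in which the path ends, so that the connection may
    -- move freely inside it.
    Cell : Fin r → Fin r → V → Set
    Cell i j x = ¬ Terminal x × ∃ λ y → y ∈ path paths (at i j) × φ y ≡ φ (inj₂ x)

    cell-disjoint : ∀ {i j k l x} → Cell i j x → Cell k l x → i ≡ k × j ≡ l
    cell-disjoint (_ , y , y∈ , eq) (_ , y′ , y′∈ , eq′) = at-injective (labels y∈ y′∈ (trans eq (≡.sym eq′)))

    drop⁺ : ∀ {a b p} → ¬ Terminal a → Walk E⁺ (inj₂ a) (inj₂ b) p →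
      ∃ λ q → Walk E a b q × (∀ {x} → x ∈ q → ¬ Terminal x × inj₂ x ∈ p)
    drop⁺ ¬t stop = _ , stop , λ { (here refl) → ¬t , here refl }
    drop⁺ ¬t (_◂_ {v = inj₂ u} (e , _ , ¬t′) w) =
      let q , w′ , sub = drop⁺ ¬t′ w
      in  _ , e ◂ w′ , λ { (here refl) → ¬t , here refl ; (there x∈) → proj₁ (sub x∈) , there (proj₂ (sub x∈)) }

    leg : ∀ i j → ∃ λ u → ∃ λ e → e ∈ U × B e u × φ (dst paths (at i j)) ≡ inj₂ (rep e) ×
      ∃ λ q → Walk E (v i) u q × (∀ {x} → x ∈ q → x ≡ v i ⊎ Cell i j x)
    leg i j with dst∈Y paths (at i j) | src∈X paths (at i j) in eq-src
    ... | u , e , eq , e∈ , b | c , eq′ = u , e , e∈ , b , trans (cong φ eq) (φ-in e∈ b) ,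
        (let q , w , sub = go (subst₂ (λ s d → Walk E⁺ s d (path paths (at i j))) (trans eq′ (cong inj₁ c≡)) eq
               (walk-map (λ _ _ → proj₁) (walk paths (at i j))))
         in  q , w , λ x∈ → Sum.map₂ (λ (¬t , x∈p) → ¬t , _ , x∈p , refl) (sub x∈))
      where
      c≡ : c ≡ combine i j
      c≡ = trans (cong proj₁ (≡.sym eq-src)) (proj₂ (from-copy (combine i j)))
      v-owner : owner (combine i j) ≡ v i
      v-owner = cong (v ∘ proj₁) (F.remQuot-combine i j)
      go : ∀ {u p} → Walk E⁺ (inj₁ (combine i j)) (inj₂ u) p →
        ∃ λ q → Walk E (v i) u q × (∀ {x} → x ∈ q → x ≡ v i ⊎ (¬ Terminal x × inj₂ x ∈ p))
      go (_◂_ {v = inj₂ y} (e , ¬t) w) =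
        let q , w′ , sub = drop⁺ ¬t w
        in  v i ∷ q , subst (λ s → E s y) v-owner e ◂ w′ ,
            λ { (here refl) → inj₁ refl
              ; (there x∈) → inj₂ (proj₁ (sub x∈) , there (proj₂ (sub x∈))) }

    -- The path from `v i` towards `v j` and the one from `v j` towards `v i` end in different
    -- branch sets, because their labels differ. An edge between these branch sets joins the two.
    link : ∀ {i j} → i ≢ j → ∃ λ q → Walk E (v i) (v j) q ×
      (∀ {x} → x ∈ q → x ≡ v i ⊎ x ≡ v j ⊎ (Cell i j x ⊎ Cell j i x))
    link {i} {j} i≢j
      with u , e , e∈ , b , lab , q , w , sub ← leg i j
         | u′ , e′ , e′∈ , b′ , lab′ , q′ , w′ , sub′ ← leg j i
      with x , y , bx , by , exy ← B-adjacent {e} {e′} (λ { refl → i≢j (proj₁ (at-injective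
          (labels (walk-end (walk paths (at i j))) (walk-end (walk paths (at j i))) (trans lab (≡.sym lab′))))) })
      with p , wp , subp ← B-connected b bx | p′ , wp′ , subp′ ← B-connected by b′
      with q″ , w″ , sub″ ← walk-reverse E-sym w′
      with q₁ , w₁ , split₁ ← walk-trans w wp | q₂ , w₂ , split₂ ← walk-trans wp′ w″
      = q₁ ++ q₂ , walk-join w₁ exy w₂ , λ z∈ → [ first , second ]′ (M.∈-++⁻ q₁ z∈)
      where
      in-branch : ∀ {i j e z} → e ∈ U → φ (dst paths (at i j)) ≡ inj₂ (rep e) → B e z → Cell i j z
      in-branch {i} {j} e∈ lab bz = clean e∈ bz , _ , walk-end (walk paths (at i j)) , trans lab (≡.sym (φ-in e∈ bz))
      first : ∀ {z} → z ∈ q₁ → z ≡ v i ⊎ z ≡ v j ⊎ (Cell i j z ⊎ Cell j i z)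
      first z∈ with split₁ z∈
      ... | inj₂ z∈p = inj₂ (inj₂ (inj₁ (in-branch e∈ lab (subp z∈p))))
      ... | inj₁ z∈q with sub z∈q
      ...   | inj₁ eq = inj₁ eq
      ...   | inj₂ cell = inj₂ (inj₂ (inj₁ cell))
      second : ∀ {z} → z ∈ q₂ → z ≡ v i ⊎ z ≡ v j ⊎ (Cell i j z ⊎ Cell j i z)
      second z∈ with split₂ z∈
      ... | inj₁ z∈p = inj₂ (inj₂ (inj₂ (in-branch e′∈ lab′ (subp′ z∈p))))
      ... | inj₂ z∈q with sub′ (sub″ z∈q)
      ...   | inj₁ eq = inj₂ (inj₁ eq)
      ...   | inj₂ cell = inj₂ (inj₂ (inj₂ cell))

  -- Restriction to a set of vertices

  choose : ∀ {n} {A B : Fin n → Set} → (∀ i → A i ⊎ B i) → (∀ i → A i) ⊎ ∃ B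
  choose {zero} f = inj₁ λ ()
  choose {suc n} f with f zero | choose (f ∘ suc)
  ... | inj₂ b | _ = inj₂ (zero , b)
  ... | inj₁ _ | inj₂ (i , b) = inj₂ (suc i , b)
  ... | inj₁ a | inj₁ as = inj₁ λ { zero → a ; (suc i) → as i }

  -- Exhaustive search, which makes freeness of a vertex decidable.
  short-list? : ∀ {n} l {Q : List (Fin n) → Set} → Decidable₁ Q → Dec (∃ λ S → length S ≤ l × Q S)
  short-list? zero Q? = map′ (λ q → [] , z≤n , q) (λ { ([] , _ , q) → q }) (Q? [])
  short-list? (suc l) Q? = map′
    (λ { (inj₁ q) → [] , z≤n , q ; (inj₂ (v , S , S≤ , q)) → v ∷ S , s≤s S≤ , q })
    (λ { ([] , _ , q) → inj₁ q ; (v ∷ S , s≤s S≤ , q) → inj₂ (v , S , S≤ , q) })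
    (Q? [] ⊎-dec F.any? (λ v → short-list? l (Q? ∘ (v ∷_))))

  module _ {V : Set} {E : V → V → Set} {X Y : V → Set} where

    select : ∀ {k m} → Family E X Y k → (Fin m → Fin k) → Family E X Y m
    select P f = record
      { path = path P ∘ f ; src = src P ∘ f ; dst = dst P ∘ f
      ; walk = walk P ∘ f ; src∈X = src∈X P ∘ f ; dst∈Y = dst∈Y P ∘ f }

    append : ∀ {k l} → Family E X Y k → Family E X Y l → Family E X Y (k + l)
    append {k} P Q = record
      { path  = λ i → [ path P , path Q ]′ (splitAt k i)
      ; src   = λ i → [ src P , src Q ]′ (splitAt k i)
      ; dst   = λ i → [ dst P , dst Q ]′ (splitAt k i)
      ; walk  = λ i → walk′ (splitAt k i)
      ; src∈X = λ i → src′ (splitAt k i)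
      ; dst∈Y = λ i → dst′ (splitAt k i)
      }
      where
      walk′ : ∀ c → Walk E ([ src P , src Q ]′ c) ([ dst P , dst Q ]′ c) ([ path P , path Q ]′ c)
      walk′ (inj₁ i) = walk P i
      walk′ (inj₂ i) = walk Q i
      src′ : ∀ c → X ([ src P , src Q ]′ c)
      src′ (inj₁ i) = src∈X P i
      src′ (inj₂ i) = src∈X Q i
      dst′ : ∀ c → Y ([ dst P , dst Q ]′ c)
      dst′ (inj₁ i) = dst∈Y P i
      dst′ (inj₂ i) = dst∈Y Q i

    append-related : ∀ {k l} (P : Family E X Y k) (Q : Family E X Y l) (_~_ : V → V → Set) →
      (∀ {i j x y} → x ∈ path P i → y ∈ path P j → x ~ y → i ≡ j) →
      (∀ {i j x y} → x ∈ path Q i → y ∈ path Q j → x ~ y → i ≡ j) →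
      (∀ {i j x y} → x ∈ path P i → y ∈ path Q j → ¬ (x ~ y)) →
      (∀ {i j x y} → x ∈ path Q i → y ∈ path P j → ¬ (x ~ y)) →
      ∀ {i j x y} → x ∈ path (append P Q) i → y ∈ path (append P Q) j → x ~ y → i ≡ j
    append-related {k} {l} P Q _~_ pp qq pq qp {i} {j} x∈ y∈ rel =
      trans (≡.sym (F.join-splitAt k l i)) (trans (cong (join k l) (same (splitAt k i) (splitAt k j) x∈ y∈)) (F.join-splitAt k l j))
      where
      same : ∀ c d → _ ∈ [ path P , path Q ]′ c → _ ∈ [ path P , path Q ]′ d → c ≡ d
      same (inj₁ a) (inj₁ b) x∈ y∈ = cong inj₁ (pp x∈ y∈ rel)
      same (inj₁ a) (inj₂ b) x∈ y∈ = ⊥-elim (pq x∈ y∈ rel)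
      same (inj₂ a) (inj₁ b) x∈ y∈ = ⊥-elim (qp x∈ y∈ rel)
      same (inj₂ a) (inj₂ b) x∈ y∈ = cong inj₂ (qq x∈ y∈ rel)

  -- The paths outside `L` meet `S` in different vertices. This counts the paths lost to a cut or to
  -- the free vertices.
  rows-covered : ∀ {V : Set} {E : V → V → Set} {X Y : V → Set} {k} (P : Family E X Y k) → Disjoint P →
    ∀ L S → (∀ i → i ∈ L ⊎ ∃ λ x → x ∈ path P i × x ∈ S) → k ≤ length L + length S
  rows-covered {k = k} P disj L S cover = begin
    k                          ≡⟨ length-tabulate {n = k} id ⟨
    length (allFin k)          ≤⟨ Unique-⊆⇒length≤ (Unique.allFin⁺ k) split ⟩
    length (L ++ rest)         ≡⟨ length-++ L ⟩
    length L + length rest     ≤⟨ ℕ.+-monoʳ-≤ (length L) (injective⇒≤length (proj₁ ∘ chosen) (proj₂ ∘ proj₂ ∘ chosen) injective) ⟩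
    length L + length S        ∎
    where
    open ℕ.≤-Reasoning
    open import Data.List.Membership.DecPropositional (F._≟_ {k}) using (_∈?_)
    import Data.List.Relation.Unary.Unique.Propositional.Properties as Unique
    rest? : Decidable₁ (_∉ L)
    rest? i = ¬? (i ∈? L)
    rest = filter rest? (allFin k)
    split : ∀ {i} → i ∈ allFin k → i ∈ L ++ rest
    split {i} i∈ with i ∈? L
    ... | yes i∈L = M.∈-++⁺ˡ i∈L
    ... | no i∉L = M.∈-++⁺ʳ L (M.∈-filter⁺ rest? i∈ i∉L)
    chosen : ∀ a → ∃ λ x → x ∈ path P (lookup rest a) × x ∈ S
    chosen a with cover (lookup rest a)
    ... | inj₁ i∈L = ⊥-elim (proj₂ (M.∈-filter⁻ rest? {xs = allFin k} (lookup∈ rest a)) i∈L)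
    ... | inj₂ x∈ = x∈
    injective : ∀ {a b} → proj₁ (chosen a) ≡ proj₁ (chosen b) → a ≡ b
    injective {a} {b} eq = lookup-injective (Unique.filter⁺ rest? (Unique.allFin⁺ k))
      (disj (proj₁ (proj₂ (chosen a))) (subst (_∈ path P (lookup rest b)) (≡.sym eq) (proj₁ (proj₂ (chosen b)))))

  -- Paths of the given graph and subdivisions of complete graphs

  module InGraph {n : ℕ} (G : Graph n) where

    toIsWalk : ∀ {a b p} → Walk (Adj G) a b p → IsWalk G p
    toIsWalk stop = single _
    toIsWalk (e ◂ stop) = step _ _ _ e (single _)
    toIsWalk (e ◂ w@(_ ◂ _)) = step _ _ _ e (toIsWalk w)

    head-walk : ∀ {a b p} → Walk (Adj G) a b p → head p ≡ just a
    head-walk stop = refl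
    head-walk (_ ◂ _) = refl

    last-walk : ∀ {a b p} → Walk (Adj G) a b p → last p ≡ just b
    last-walk stop = refl
    last-walk (_ ◂ stop) = refl
    last-walk (_ ◂ w@(_ ◂ _)) = last-walk w

    fromIsWalk : ∀ {a b p} → IsWalk G p → head p ≡ just a → last p ≡ just b → Walk (Adj G) a b p
    fromIsWalk (single v) refl refl = stop
    fromIsWalk (step u v vs e w) refl eq = e ◂ fromIsWalk w refl eq

    open InducedPaths (F._≟_ {n}) (adj? G) (sym G) (irrefl G) public

    toPathFromTo : ∀ {a b p} → InducedPath a b p → IsPathFromTo G a b p
    toPathFromTo π = (toIsWalk (toWalk π) , unique π) , head-walk (toWalk π) , last-walk (toWalk π)

    Inside : (Fin n → Set) → Fin n → Fin n → Set
    Inside U u v = Adj G u v × U u × U v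

    inside? : ∀ {U} → Decidable₁ U → Decidable (Inside U)
    inside? U? u v = adj? G u v ×-dec U? u ×-dec U? v

    inside-sym : ∀ {U} → Symmetric (Inside U)
    inside-sym (e , a , b) = sym G e , b , a

    module TopologicalMinor {r : ℕ} (v : Fin r → Fin n) (v-injective : ∀ {i j} → v i ≡ v j → i ≡ j)
      (Cell : Fin r → Fin r → Fin n → Set)
      (nonterminal : ∀ {i j x} → Cell i j x → ∀ t → x ≢ v t)
      (cell-disjoint : ∀ {i j k l x} → Cell i j x → Cell k l x → i ≡ k × j ≡ l)
      (link : ∀ {i j} → i ≢ j → ∃ λ q → Walk (Adj G) (v i) (v j) q ×
        (∀ {x} → x ∈ q → x ≡ v i ⊎ x ≡ v j ⊎ (Cell i j x ⊎ Cell j i x))) where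

      arc : ∀ i j → Dec (i ≡ j) → List (Fin n)
      -- A default value: conditions are imposed only on pairs with i < j.
      arc i j (yes _)  = []
      arc i j (no i≢j) = proj₁ (shortcut (proj₁ (proj₂ (link i≢j))))

      arc-path : ∀ {i j} → i ≢ j → ∀ d → IsPathFromTo G (v i) (v j) (arc i j d)
      arc-path i≢j (yes eq) = ⊥-elim (i≢j eq)
      arc-path i≢j (no ne) = toPathFromTo (proj₁ (proj₂ (shortcut (proj₁ (proj₂ (link ne))))))

      arc-cells : ∀ {i j x} d → x ∈ arc i j d → x ≡ v i ⊎ x ≡ v j ⊎ (Cell i j x ⊎ Cell j i x)
      arc-cells (no ne) x∈ = proj₂ (proj₂ (link ne)) (proj₂ (proj₂ (shortcut (proj₁ (proj₂ (link ne))))) x∈)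

      -- An arc uses the cells of both orientations of its pair; the ordering of the two pairs rules
      -- out that they agree only after a reversal.
      crossing : ∀ {i j k l x} → i <ᶠ j → k <ᶠ l → Cell i j x ⊎ Cell j i x → Cell k l x ⊎ Cell l k x → k ≡ i × l ≡ j
      crossing i<j k<l (inj₁ c) (inj₁ c′) = let a , b = cell-disjoint c c′ in ≡.sym a , ≡.sym b
      crossing i<j k<l (inj₂ c) (inj₂ c′) = let a , b = cell-disjoint c c′ in ≡.sym b , ≡.sym a
      crossing i<j k<l (inj₁ c) (inj₂ c′) with refl , refl ← cell-disjoint c c′ = ⊥-elim (F.<-asym i<j k<l)
      crossing i<j k<l (inj₂ c) (inj₁ c′) with refl , refl ← cell-disjoint c c′ = ⊥-elim (F.<-asym i<j k<l)

      minor : HasTopMinorK r G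
      minor = v , (λ i j → arc i j (i F.≟ j)) , v-injective ,
        (λ i j i<j → arc-path (F.<⇒≢ i<j) (i F.≟ j)) , condition
        where
        condition : ∀ i j → i <ᶠ j → ∀ x → x ∈ arc i j (i F.≟ j) → x ≡ v i ⊎ x ≡ v j ⊎
          ((∀ t → x ≢ v t) × (∀ k l → k <ᶠ l → ¬ (k ≡ i × l ≡ j) → ¬ (x ∈ arc k l (k F.≟ l))))
        condition i j i<j x x∈ with arc-cells (i F.≟ j) x∈
        ... | inj₁ eq = inj₁ eq
        ... | inj₂ (inj₁ eq) = inj₂ (inj₁ eq)
        ... | inj₂ (inj₂ cell) = inj₂ (inj₂ (interior , λ k l k<l ne x∈′ → other k<l ne (arc-cells (k F.≟ l) x∈′)))
          where
          interior : ∀ t → x ≢ v t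
          interior = [ nonterminal , nonterminal ]′ cell
          other : ∀ {k l} → k <ᶠ l → ¬ (k ≡ i × l ≡ j) → ¬ (x ≡ v k ⊎ x ≡ v l ⊎ (Cell k l x ⊎ Cell l k x))
          other k<l ne (inj₁ eq) = interior _ eq
          other k<l ne (inj₂ (inj₁ eq)) = interior _ eq
          other k<l ne (inj₂ (inj₂ cell′)) = ne (crossing i<j k<l cell cell′)

  -- The induction on the number of paths

  -- In the linking, a separator of the r² copies has fewer than r² elements, and up to r terminals
  -- are added to it.
  cutSize : ℕ → ℕ
  cutSize r = r + r * r

  -- The summands serve the independent set of paths, the contraction with its bounded-degree
  -- argument, and the paths lost to free vertices (r) or to a split (`cutSize r`).
  denominator : ℕ → ℕ
  denominator r = 2 * branchCount r + cutSize r * degreeFactor (cutSize r) + (r + cutSize r)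

  branches≤denominator : ∀ r → 2 * branchCount r ≤ denominator r
  branches≤denominator r = ℕ.≤-trans (ℕ.m≤m+n (2 * branchCount r) (cutSize r * degreeFactor (cutSize r)))
    (ℕ.m≤m+n (2 * branchCount r + cutSize r * degreeFactor (cutSize r)) (r + cutSize r))

  r+cut≤denominator : ∀ r → r + cutSize r ≤ denominator r
  r+cut≤denominator r = ℕ.m≤n+m (r + cutSize r) (2 * branchCount r + cutSize r * degreeFactor (cutSize r))

  contraction≤denominator : ∀ r → cutSize r * degreeFactor (cutSize r) + (r + cutSize r) ≤ denominator r
  contraction≤denominator r = ℕ.+-monoˡ-≤ (r + cutSize r) (ℕ.m≤n+m (cutSize r * degreeFactor (cutSize r)) (2 * branchCount r))

  module Induction {n : ℕ} (G : Graph n) {r : ℕ} (1≤r : 1 ≤ r) (no-minor : ¬ HasTopMinorK r G)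
    {X Y : Fin n → Set} (X? : Decidable₁ X) (Y? : Decidable₁ Y) where
    open InGraph G using (Inside; inside?; inside-sym; module TopologicalMinor)
    open import Data.List.Membership.DecPropositional (F._≟_ {n}) using (_∈?_)
    import Data.List.Relation.Unary.Unique.Propositional.Properties as Unique
    open MengerTheorem (Fin-finite n) using (reachable?)

    s M : ℕ
    s = cutSize r
    M = denominator r

    1≤s : 1 ≤ s
    1≤s = ℕ.≤-trans 1≤r (ℕ.m≤m+n r (r * r))

    System : (Fin n → Set) → ℕ → Set
    System U k = Family (Inside U) (λ v → X v × U v) (λ v → Y v × U v) k

    inside : ∀ {U k} (P : System U k) {i x} → x ∈ path P i → U x
    inside P {i} = walk-all (proj₂ ∘ proj₂) (proj₂ (src∈X P i)) (walk P i)

    Result : (Fin n → Set) → ℕ → Set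
    Result U k = ∃ λ m → Σ (System U m) λ Q → Disjoint Q × NonAdjacent Q × k + M ≤ 2 * M * m

    enough : ∀ {U k m} → 1 ≤ k → (Q : System U m) → Disjoint Q → NonAdjacent Q → k ≤ M * m → Result U k
    enough {m = zero} 1≤k Q disj nonadj k≤ = ⊥-elim (ℕ.<⇒≱ 1≤k (ℕ.≤-trans k≤ (ℕ.≤-reflexive (ℕ.*-zeroʳ M))))
    enough {k = k} {m = m@(suc m′)} 1≤k Q disj nonadj k≤ = m , Q , disj , nonadj , (begin
      k + M            ≤⟨ ℕ.+-mono-≤ k≤ (ℕ.≤-trans (ℕ.m≤m+n M (M * m′)) (ℕ.≤-reflexive (≡.sym (ℕ.*-suc M m′)))) ⟩
      M * m + M * m    ≡⟨ cong (M * m +_) (ℕ.+-identityʳ (M * m)) ⟨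
      2 * (M * m)      ≡⟨ ℕ.*-assoc 2 M m ⟨
      2 * M * m        ∎)
      where open ℕ.≤-Reasoning

    restrict : ∀ {U U′ k} (P : System U k) → (∀ {i x} → x ∈ path P i → U′ x) → System U′ k
    restrict P in′ = record
      { path  = path P
      ; src   = src P
      ; dst   = dst P
      ; walk  = λ i → walk-map (λ u∈ v∈ (e , _) → e , in′ u∈ , in′ v∈) (walk P i)
      ; src∈X = λ i → proj₁ (src∈X P i) , in′ (walk-start (walk P i))
      ; dst∈Y = λ i → proj₁ (dst∈Y P i) , in′ (walk-end (walk P i))
      }

    module Step {U : Fin n → Set} (U? : Decidable₁ U) {k : ℕ} (1≤k : 1 ≤ k) (P : System U k) (P-disj : Disjoint P)
      (smaller : ∀ {U′ k′} → Decidable₁ U′ → 1 ≤ k′ → k′ < k → (Q : System U′ k′) → Disjoint Q → Result U′ k′) where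

      E = Inside U
      E? = inside? U?

      H : Fin k → Fin k → Set
      H i j = Any (λ x → Any (E x) (path P j)) (path P i)

      H? : Decidable H
      H? i j = any? (λ x → any? (E? x) (path P j)) (path P i)

      H-intro : ∀ {i j x y} → x ∈ path P i → y ∈ path P j → E x y → H i j
      H-intro x∈ y∈ e = Any.map (λ { refl → Any.map (λ { refl → e }) y∈ }) x∈

      H-elim : ∀ {i j} → H i j → ∃ λ x → ∃ λ y → x ∈ path P i × y ∈ path P j × E x y
      H-elim h = let x , x∈ , h′ = find h ; y , y∈ , e = find h′ in x , y , x∈ , y∈ , e

      H-sym : Symmetric H
      H-sym h = let _ , _ , x∈ , y∈ , e = H-elim h in H-intro y∈ x∈ (inside-sym {U} e)

      open DuchetMeyniel (F._≟_ {k}) H? H-sym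

      from-independent : (I : Independent (allFin k)) → length (allFin k) ≤ 2 * branchCount r * length (Independent.set I) →
        Result U k
      from-independent I k≤ = enough 1≤k (select P (lookup set))
        (λ x∈ x∈′ → lookup-injective set-unique (P-disj x∈ x∈′))
        (λ {a} {b} x∈ y∈ e → lookup-injective set-unique
          ([ (λ ¬h → ⊥-elim (¬h (H-intro x∈ y∈ e))) , id ]′ (independent (lookup∈ set a) (lookup∈ set b))))
        (begin
          k                                      ≡⟨ length-tabulate {n = k} id ⟨
          length (allFin k)                      ≤⟨ k≤ ⟩
          2 * branchCount r * length set         ≤⟨ ℕ.*-monoˡ-≤ (length set) (branches≤denominator r) ⟩
          M * length set                         ∎)
        where
        open Independent I
        open ℕ.≤-Reasoning

      Reach : List (Fin n) → Fin n → Fin n → Set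
      Reach S v x = ∃ λ p → Walk (Entering E (_∈ S)) v x p

      reach? : ∀ S v → Decidable₁ (Reach S v)
      reach? S v x = reachable? (λ u w → E? u w ×-dec ¬? (w ∈? S)) v x

      Unhit : List (Fin n) → Fin k → Set
      Unhit S i = All (_∉ S) (path P i)

      unhit? : ∀ S → Decidable₁ (Unhit S)
      unhit? S i = All.all? (λ x → ¬? (x ∈? S)) (path P i)

      Hidden Seen : List (Fin n) → Fin n → Fin k → Set
      Hidden S v i = All (λ x → ¬ Reach S v x) (path P i)
      Seen   S v i = Any (Reach S v) (path P i)

      Separated : Fin n → List (Fin n) → Set
      Separated v S = v ∉ S × ∃ λ i → Unhit S i × Hidden S v i

      -- Freeness is the negation of this.
      Bound : Fin n → Set
      Bound v = ∃ λ S → length S ≤ s × Separated v S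

      bound? : Decidable₁ Bound
      bound? v = short-list? s λ S → ¬? (v ∈? S) ×-dec
        F.any? λ i → unhit? S i ×-dec All.all? (λ x → ¬? (reach? S v x)) (path P i)

      Cut : Fin n → Set
      Cut v = ∃ λ S → length S ≤ s × v ∉ S ×
        (∀ {i x p} → Walk (Entering E (_∈ S)) v x p → x ∈ path P i → ∃ λ y → y ∈ path P i × y ∈ S)

      Splitting : Fin n → Set
      Splitting v = ∃ λ S → length S ≤ s × (∃ λ i → Unhit S i × Hidden S v i) × (∃ λ j → Unhit S j × Seen S v j)

      -- Let `S` hide an unhit path from `v`. If some other unhit path is seen from `v`, then `S`
      -- splits the system; if there is none, every path seen from `v` meets `S`, and this is a cut.
      classify : ∀ v → (¬ Bound v ⊎ Cut v) ⊎ Splitting v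
      classify v with bound? v
      ... | no ¬b = inj₁ (inj₁ ¬b)
      ... | yes (S , |S|≤ , v∉S , hidden) with F.any? (λ j → unhit? S j ×-dec any? (reach? S v) (path P j))
      ...   | yes seen = inj₂ (S , |S|≤ , hidden , seen)
      ...   | no none = inj₁ (inj₂ (S , |S|≤ , v∉S , meets))
        where
        meets : ∀ {i x p} → Walk (Entering E (_∈ S)) v x p → x ∈ path P i → ∃ λ y → y ∈ path P i × y ∈ S
        meets {i} w x∈ with any? (_∈? S) (path P i)
        ... | yes hit = find hit
        ... | no ¬hit = ⊥-elim (none (i , All.tabulate (λ y∈ y∈S → ¬hit (Any.map (λ { refl → y∈S }) y∈)) ,
                                      Any.map (λ { refl → _ , w }) x∈))

      module Split {v : Fin n} (S : List (Fin n)) (|S|≤s : length S ≤ s)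
        {i₂ : Fin k} (unhit₂ : Unhit S i₂) (hidden : Hidden S v i₂) {i₁ : Fin k} (unhit₁ : Unhit S i₁) (seen : Seen S v i₁) where

        U₁ U₂ : Fin n → Set
        U₁ x = U x × Reach S v x
        U₂ x = U x × ¬ Reach S v x × x ∉ S

        first? : Decidable₁ (λ i → Unhit S i × Seen S v i)
        first? i = unhit? S i ×-dec any? (reach? S v) (path P i)

        second? : Decidable₁ (λ i → Unhit S i × ¬ Seen S v i)
        second? i = unhit? S i ×-dec ¬? (any? (reach? S v) (path P i))

        L₁ L₂ : List (Fin k)
        L₁ = filter first? (allFin k)
        L₂ = filter second? (allFin k)

        L₁⁻ : ∀ a → Unhit S (lookup L₁ a) × Seen S v (lookup L₁ a)
        L₁⁻ a = proj₂ (M.∈-filter⁻ first? {xs = allFin k} (lookup∈ L₁ a))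

        L₂⁻ : ∀ a → Unhit S (lookup L₂ a) × ¬ Seen S v (lookup L₂ a)
        L₂⁻ a = proj₂ (M.∈-filter⁻ second? {xs = allFin k} (lookup∈ L₂ a))

        i₁∈L₁ : i₁ ∈ L₁
        i₁∈L₁ = M.∈-filter⁺ first? (M.∈-allFin i₁) (unhit₁ , seen)

        i₂∈L₂ : i₂ ∈ L₂
        i₂∈L₂ = M.∈-filter⁺ second? (M.∈-allFin i₂)
          (unhit₂ , λ any → let _ , x∈ , reach = find any in All.lookup hidden x∈ reach)

        L₁-unique : Unique L₁
        L₁-unique = Unique.filter⁺ first? (Unique.allFin⁺ k)

        L₂-unique : Unique L₂
        L₂-unique = Unique.filter⁺ second? (Unique.allFin⁺ k)

        apart : ∀ {i} → i ∈ L₁ → i ∉ L₂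
        apart i∈₁ i∈₂ = proj₂ (proj₂ (M.∈-filter⁻ second? {xs = allFin k} i∈₂))
          (proj₂ (proj₂ (M.∈-filter⁻ first? {xs = allFin k} i∈₁)))

        missing<k : ∀ {L : List (Fin k)} {i} → Unique L → i ∉ L → length L < k
        missing<k un i∉ = ℕ.≤-trans
          (Unique-⊆⇒length≤ (All.tabulate (λ { x∈ refl → i∉ x∈ }) AllPairs.∷ un) (λ {x} _ → M.∈-allFin x))
          (ℕ.≤-reflexive (length-tabulate {n = k} id))

        k≤ : k ≤ length L₁ + length L₂ + s
        k≤ = begin
          k                                 ≤⟨ rows-covered P P-disj (L₁ ++ L₂) S cover ⟩
          length (L₁ ++ L₂) + length S      ≤⟨ ℕ.+-monoʳ-≤ (length (L₁ ++ L₂)) |S|≤s ⟩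
          length (L₁ ++ L₂) + s             ≡⟨ cong (_+ s) (length-++ L₁) ⟩
          length L₁ + length L₂ + s         ∎
          where
          open ℕ.≤-Reasoning
          cover : ∀ i → i ∈ L₁ ++ L₂ ⊎ ∃ λ x → x ∈ path P i × x ∈ S
          cover i with any? (_∈? S) (path P i)
          ... | yes hit = inj₂ (find hit)
          ... | no ¬hit = inj₁ (side (any? (reach? S v) (path P i)))
            where
            unhit : Unhit S i
            unhit = All.tabulate λ y∈ y∈S → ¬hit (Any.map (λ { refl → y∈S }) y∈)
            side : Dec (Seen S v i) → i ∈ L₁ ++ L₂
            side (yes sn) = M.∈-++⁺ˡ (M.∈-filter⁺ first? (M.∈-allFin i) (unhit , sn))
            side (no ¬sn) = M.∈-++⁺ʳ L₁ (M.∈-filter⁺ second? (M.∈-allFin i) (unhit , ¬sn))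

        reach-extend : ∀ {x y p} → Reach S v x → Walk E x y p → (∀ {u} → u ∈ p → u ∉ S) → Reach S v y
        reach-extend (q , w) w′ off = let r , w″ , _ = walk-trans w (walk-map (λ _ u∈ e → e , off u∈) w′) in r , w″

        -- A path that avoids `S` is connected off `S`, so it is reached in all of its vertices or
        -- in none.
        reached : ∀ {i x} → Unhit S i → Seen S v i → x ∈ path P i → Reach S v x
        reached {i} unhit sn x∈ =
          let y , y∈ , ry = find sn
              q , w , sub = walk-between inside-sym (walk P i) y∈ x∈
          in  reach-extend ry w (λ u∈ → All.lookup unhit (sub u∈))

        P₁ : System U₁ (length L₁)
        P₁ = restrict (select P (lookup L₁)) (λ {a} x∈ → inside P x∈ , reached (proj₁ (L₁⁻ a)) (proj₂ (L₁⁻ a)) x∈)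

        P₂ : System U₂ (length L₂)
        P₂ = restrict (select P (lookup L₂)) (λ {a} x∈ → inside P x∈ ,
          (λ r → proj₂ (L₂⁻ a) (Any.map (λ { refl → r }) x∈)) , All.lookup (proj₁ (L₂⁻ a)) x∈)

        result : Result U k
        result with smaller (λ x → U? x ×-dec reach? S v x) (M.∈-length i₁∈L₁)
                      (missing<k L₁-unique (λ i₂∈L₁ → apart i₂∈L₁ i₂∈L₂)) P₁
                      (λ x∈ x∈′ → lookup-injective L₁-unique (P-disj x∈ x∈′))
                  | smaller (λ x → U? x ×-dec ¬? (reach? S v x) ×-dec ¬? (x ∈? S)) (M.∈-length i₂∈L₂)
                      (missing<k L₂-unique (apart i₁∈L₁)) P₂
                      (λ x∈ x∈′ → lookup-injective L₂-unique (P-disj x∈ x∈′))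
        ... | m₁ , Q₁ , disj₁ , nonadj₁ , bound₁ | m₂ , Q₂ , disj₂ , nonadj₂ , bound₂ =
          m₁ + m₂ , append R₁ R₂ ,
          (λ x∈ x∈′ → append-related R₁ R₂ _≡_
            (λ { x∈ y∈ refl → disj₁ x∈ y∈ }) (λ { x∈ y∈ refl → disj₂ x∈ y∈ })
            (λ { x∈ y∈ refl → proj₁ (proj₂ (inside Q₂ y∈)) (proj₂ (inside Q₁ x∈)) })
            (λ { x∈ y∈ refl → proj₁ (proj₂ (inside Q₂ x∈)) (proj₂ (inside Q₁ y∈)) }) x∈ x∈′ refl) ,
          append-related R₁ R₂ E
            (λ x∈ y∈ (e , _) → nonadj₁ x∈ y∈ (e , inside Q₁ x∈ , inside Q₁ y∈))
            (λ x∈ y∈ (e , _) → nonadj₂ x∈ y∈ (e , inside Q₂ x∈ , inside Q₂ y∈))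
            (λ x∈ y∈ e → across (inside Q₁ x∈) (inside Q₂ y∈) e)
            (λ x∈ y∈ e → across (inside Q₁ y∈) (inside Q₂ x∈) (inside-sym e)) ,
          (begin
            -- The second `M` on the right comes from having two sides; it absorbs the at most `s`
            -- paths that meet `S`.
            k + M                                          ≤⟨ ℕ.+-monoˡ-≤ M (ℕ.≤-trans k≤ (ℕ.+-monoʳ-≤ (length L₁ + length L₂) s≤M)) ⟩
            length L₁ + length L₂ + M + M                  ≡⟨ arrange (length L₁) (length L₂) M ⟩
            (length L₁ + M) + (length L₂ + M)              ≤⟨ ℕ.+-mono-≤ bound₁ bound₂ ⟩
            2 * M * m₁ + 2 * M * m₂                        ≡⟨ ℕ.*-distribˡ-+ (2 * M) m₁ m₂ ⟨
            2 * M * (m₁ + m₂)                              ∎)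
          where
          open ℕ.≤-Reasoning hiding (stop)
          R₁ = restrict Q₁ (proj₁ ∘ inside Q₁)
          R₂ = restrict Q₂ (proj₁ ∘ inside Q₂)
          across : ∀ {x y} → U₁ x → U₂ y → ¬ E x y
          across (Ux , rx) (Uy , ¬ry , y∉S) e =
            ¬ry (let q , w = rx in _ , walk-join w (e , y∉S) stop)
          s≤M : s ≤ M
          s≤M = ℕ.≤-trans (ℕ.m≤n+m s r) (r+cut≤denominator r)
          arrange : ∀ a b c → a + b + c + c ≡ (a + c) + (b + c)
          arrange = solve-∀

      module _ (model : CliqueModel (allFin k) (branchCount r)) where
        open CliqueModel model

        BranchSet : Fin (branchCount r) → Fin n → Set
        BranchSet j x = ∃ λ i → i ∈ branch j × x ∈ path P i

        branchSet? : ∀ j → Decidable₁ (BranchSet j)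
        branchSet? j x = F.any? λ i → (i ∈ᵏ? branch j) ×-dec (x ∈? path P i)
          where open import Data.List.Membership.DecPropositional (F._≟_ {k}) using () renaming (_∈?_ to _∈ᵏ?_)

        along : ∀ {i j p x y} → Walk H i j p → x ∈ path P i → y ∈ path P j →
          ∃ λ q → Walk E x y q × (∀ {u} → u ∈ q → ∃ λ l → l ∈ p × u ∈ path P l)
        along {i} stop x∈ y∈ =
          let q , w , sub = walk-between inside-sym (walk P i) x∈ y∈ in q , w , λ u∈ → i , here refl , sub u∈
        along {i} (h ◂ w) x∈ y∈ =
          let x′ , y′ , x′∈ , y′∈ , e = H-elim h
              q₁ , w₁ , sub₁ = walk-between inside-sym (walk P i) x∈ x′∈
              q₂ , w₂ , sub₂ = along w y′∈ y∈
          in  q₁ ++ q₂ , walk-join w₁ e w₂ , λ u∈ →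
              [ (λ u∈₁ → i , here refl , sub₁ u∈₁) , (λ u∈₂ → let l , l∈ , u∈l = sub₂ u∈₂ in l , there l∈ , u∈l) ]′ (M.∈-++⁻ q₁ u∈)

        branch-member : ∀ j → ∃ (BranchSet j)
        branch-member j = let i , i∈ = member j in src P i , i , i∈ , walk-start (walk P i)

        branch-disjoint : ∀ {i j x} → BranchSet i x → BranchSet j x → i ≡ j
        branch-disjoint {j = j} (i , i∈ , x∈) (i′ , i′∈ , x∈′) = disjoint i∈ (subst (_∈ branch j) (≡.sym (P-disj x∈ x∈′)) i′∈)

        branch-connected : ∀ {j x y} → BranchSet j x → BranchSet j y →
          ∃ λ p → Walk E x y p × (∀ {u} → u ∈ p → BranchSet j u)
        branch-connected (i , i∈ , x∈) (i′ , i′∈ , y∈) =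
          let p , w , sub = connected i∈ i′∈
              q , w′ , sub′ = along w x∈ y∈
          in  q , w′ , λ u∈ → let l , l∈ , u∈l = sub′ u∈ in l , sub l∈ , u∈l

        branch-adjacent : ∀ {i j} → i ≢ j → ∃ λ x → ∃ λ y → BranchSet i x × BranchSet j y × E x y
        branch-adjacent i≢j =
          let a , b , a∈ , b∈ , h = adjacent i≢j
              x , y , x∈ , y∈ , e = H-elim h
          in  x , y , (a , a∈ , x∈) , (b , b∈ , y∈) , e

        minor-from-free : (v : Fin r → Fin n) → (∀ {i j} → v i ≡ v j → i ≡ j) → (∀ i → ¬ Bound (v i)) → HasTopMinorK r G
        minor-from-free v v-injective free = TopologicalMinor.minor v v-injective L.Cell
            (λ cell t eq → proj₁ cell (t , ≡.sym eq)) L.cell-disjoint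
            (λ i≢j → let q , w , cells = L.link i≢j in q , walk-map (λ _ _ → proj₁) w , cells)
          where
          -- Freeness speaks of given paths. A branch set that avoids `S` contains a given path that
          -- avoids `S`, and reaching this path means reaching the branch set.
          unseparated : ∀ i S → length S ≤ r + r * r → v i ∉ S → ∀ j → (∀ {x} → BranchSet j x → x ∉ S) →
            ¬ (∀ {x p} → BranchSet j x → ¬ Walk (Entering E (_∈ S)) (v i) x p)
          unseparated i S |S|≤ v∉S j unhit unreachable =
            let a , a∈ = member j
            in  free i (S , |S|≤ , v∉S , a , All.tabulate (λ x∈ → unhit (a , a∈ , x∈)) ,
                        All.tabulate (λ x∈ (_ , w) → unreachable (a , a∈ , x∈) w))
          module L = Linking (Fin-finite n) E? inside-sym v BranchSet branchSet?
            branch-member branch-disjoint branch-connected branch-adjacent unseparated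

        free? : Decidable₁ (λ v → ¬ Bound v)
        free? v = ¬? (bound? v)

        frees : List (Fin n)
        frees = filter free? (allFin n)

        few-free : length frees < r
        few-free = ℕ.≰⇒> λ r≤ → no-minor (minor-from-free (λ i → lookup frees (inject≤ i r≤))
          (λ eq → F.inject≤-injective r≤ r≤ _ _ (lookup-injective (Unique.filter⁺ free? (Unique.allFin⁺ n)) eq))
          (λ i → proj₂ (M.∈-filter⁻ free? {xs = allFin n} (lookup∈ frees (inject≤ i r≤)))))

        module _ (all-cut : ∀ v → ¬ Bound v ⊎ Cut v) where

          U′ : Fin n → Set
          U′ x = U x × x ∉ frees

          U′? : Decidable₁ U′
          U′? x = U? x ×-dec ¬? (x ∈? frees)

          L : List (Fin k)
          L = filter (unhit? frees) (allFin k)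

          L-unique : Unique L
          L-unique = Unique.filter⁺ (unhit? frees) (Unique.allFin⁺ k)

          P′ : System U′ (length L)
          P′ = restrict (select P (lookup L)) (λ {a} x∈ → inside P x∈ ,
            All.lookup (proj₂ (M.∈-filter⁻ (unhit? frees) {xs = allFin k} (lookup∈ L a))) x∈)

          k≤′ : k ≤ length L + r
          k≤′ = ℕ.≤-trans (rows-covered P P-disj L frees cover) (ℕ.+-monoʳ-≤ (length L) (ℕ.<⇒≤ few-free))
            where
            cover : ∀ i → i ∈ L ⊎ ∃ λ x → x ∈ path P i × x ∈ frees
            cover i with any? (_∈? frees) (path P i)
            ... | yes hit = inj₂ (find hit)
            ... | no ¬hit = inj₁ (M.∈-filter⁺ (unhit? frees) (M.∈-allFin i)
                    (All.tabulate λ y∈ y∈F → ¬hit (Any.map (λ { refl → y∈F }) y∈)))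

          -- The free vertices have been removed, so every remaining vertex has a cut; removing
          -- vertices only shrinks the region behind it.
          cut′ : ∀ v → U′ v → ∃ λ S → length S ≤ s × v ∉ S ×
            (∀ {a x p} → Walk (Entering (Inside U′) (_∈ S)) v x p → x ∈ path P′ a → ∃ λ y → y ∈ path P′ a × y ∈ S)
          cut′ v (_ , v∉) with all-cut v
          ... | inj₁ ¬b = ⊥-elim (v∉ (M.∈-filter⁺ free? (M.∈-allFin v) ¬b))
          ... | inj₂ (S , |S|≤ , v∉S , meets) =
            S , |S|≤ , v∉S , λ w → meets (walk-map (λ _ _ ((e , (Uu , _) , (Uv , _)) , off) → (e , Uu , Uv) , off) w)

          abstract
            contracted : ∃ λ m → length L ≤ s * (degreeFactor s * m) × Σ (System U′ m) λ Q → Disjoint Q × NonAdjacent Q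
            contracted = Contraction.nonadjacent-via-contraction (Fin-finite n) (inside? U′?) inside-sym U′? proj₂ 1≤s
              P′ (inside P′) cut′ (λ x → X? x ×-dec U′? x) (λ x → Y? x ×-dec U′? x) proj₂ proj₂
              (λ x∈ x∈′ → lookup-injective L-unique (P-disj x∈ x∈′))

          from-contraction : Result U k
          from-contraction with contracted
          -- Here all paths meet free vertices, so k is at most r, and any single one of the given
          -- paths suffices.
          ... | zero , |L|≤ , _ = enough 1≤k (select P (λ (_ : Fin 1) → fromℕ< 1≤k))
              (λ { {zero} {zero} _ _ → refl }) (λ { {zero} {zero} _ _ _ → refl })
              (begin
                k                                     ≤⟨ k≤′ ⟩
                length L + r                          ≤⟨ ℕ.+-monoˡ-≤ r |L|≤ ⟩
                s * (degreeFactor s * 0) + r          ≡⟨ cong (λ e → s * e + r) (ℕ.*-zeroʳ (degreeFactor s)) ⟩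
                s * 0 + r                             ≡⟨ cong (_+ r) (ℕ.*-zeroʳ s) ⟩
                r                                     ≤⟨ ℕ.≤-trans (ℕ.m≤m+n r s) (r+cut≤denominator r) ⟩
                M                                     ≡⟨ ℕ.*-identityʳ M ⟨
                M * 1                                 ∎)
            where open ℕ.≤-Reasoning
          ... | m@(suc m′) , |L|≤ , Q , disj , nonadj = enough 1≤k (restrict Q (proj₁ ∘ inside Q)) disj
              (λ x∈ y∈ (e , _) → nonadj x∈ y∈ (e , inside Q x∈ , inside Q y∈))
              (begin
                k                                     ≤⟨ k≤′ ⟩
                length L + r                          ≤⟨ ℕ.+-mono-≤ |L|≤ (ℕ.≤-trans (ℕ.m≤m+n r s) (ℕ.m≤m*n (r + s) m)) ⟩
                s * (degreeFactor s * m) + (r + s) * m  ≡⟨ cong (_+ (r + s) * m) (ℕ.*-assoc s (degreeFactor s) m) ⟨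
                s * degreeFactor s * m + (r + s) * m  ≡⟨ ℕ.*-distribʳ-+ m (s * degreeFactor s) (r + s) ⟨
                (s * degreeFactor s + (r + s)) * m    ≤⟨ ℕ.*-monoˡ-≤ m (contraction≤denominator r) ⟩
                M * m                                 ∎)
            where open ℕ.≤-Reasoning

      step-result : Result U k
      step-result with duchet-meyniel (branchCount r) (allFin k) (Unique.allFin⁺ k)
      ... | inj₁ (I , k≤) = from-independent I k≤
      ... | inj₂ model with choose classify
      ...   | inj₁ all-cut = from-contraction model all-cut
      ...   | inj₂ (v , S , |S|≤ , (_ , unhit₂ , hidden) , (_ , unhit₁ , seen)) =
        Split.result {v} S |S|≤ unhit₂ hidden unhit₁ seen

    nonadjacent-system : ∀ fuel {U k} → k ≤ fuel → Decidable₁ U → 1 ≤ k → (P : System U k) → Disjoint P → Result U k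
    nonadjacent-system zero k≤ U? 1≤k P disj = ⊥-elim (ℕ.<⇒≱ 1≤k k≤)
    nonadjacent-system (suc fuel) k≤ U? 1≤k P disj = Step.step-result U? 1≤k P disj
      (λ U′? 1≤k′ k′<k → nonadjacent-system fuel (ℕ.≤-pred (ℕ.≤-trans k′<k k≤)) U′? 1≤k′)

  -- The constant

  open import Data.Integer using (+_)

  -- With ε = 1 / (2M) the bound ε k + ½ ≤ m reads k + M ≤ 2 M m.
  rational-bound : ∀ M k m → k + suc M ≤ 2 * suc M * m →
    (((+ 1 / (2 * suc M)) *ℚ (+ k / 1)) +ℚ ½) ≤ℚ (+ m / 1)
  rational-bound M k m k+M≤ = ℚ.toℚᵘ-cancel-≤ (begin
    toℚᵘ ((+ 1 / (2 * suc M)) *ℚ (+ k / 1) +ℚ ½)                     ≃⟨ ℚ.toℚᵘ-homo-+ ((+ 1 / (2 * suc M)) *ℚ (+ k / 1)) ½ ⟩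
    toℚᵘ ((+ 1 / (2 * suc M)) *ℚ (+ k / 1)) ℚᵘ.+ toℚᵘ ½              ≃⟨ ℚᵘ.+-congˡ (toℚᵘ ½) (ℚ.toℚᵘ-homo-* (+ 1 / (2 * suc M)) (+ k / 1)) ⟩
    toℚᵘ (+ 1 / (2 * suc M)) ℚᵘ.* toℚᵘ (+ k / 1) ℚᵘ.+ toℚᵘ ½         ≃⟨ ℚᵘ.+-congˡ (toℚᵘ ½) (ℚᵘ.*-cong (ℚ.toℚᵘ-fromℚᵘ ε) (ℚ.toℚᵘ-fromℚᵘ κ)) ⟩
    ε ℚᵘ.* κ ℚᵘ.+ toℚᵘ ½                                             ≤⟨ ℚᵘ.*≤* numerators ⟩
    mkℚᵘ (+ m) 0                                                     ≃⟨ ℚ.toℚᵘ-fromℚᵘ (mkℚᵘ (+ m) 0) ⟨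
    toℚᵘ (+ m / 1)                                                   ∎)
    where
    open ℚᵘ.≤-Reasoning
    ε = mkℚᵘ (+ 1) (M + (suc M + 0))
    κ = mkℚᵘ (+ k) 0
    D = 2 * suc M
    lhs : + ((1 * k * 2 + 1 * (D * 1)) * 1) ≡ (+ 1 ℤ.* + k ℤ.* + 2 ℤ.+ + 1 ℤ.* + (D * 1)) ℤ.* + 1
    lhs = trans (ℤ.pos-* (1 * k * 2 + 1 * (D * 1)) 1) (cong (ℤ._* + 1) (trans (ℤ.pos-+ (1 * k * 2) (1 * (D * 1)))
      (cong₂ ℤ._+_ (trans (ℤ.pos-* (1 * k) 2) (cong (ℤ._* + 2) (ℤ.pos-* 1 k))) (ℤ.pos-* 1 (D * 1)))))
    expandˡ : ∀ k M → (1 * k * 2 + 1 * (2 * suc M * 1)) * 1 ≡ 2 * (k + suc M)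
    expandˡ = solve-∀
    expandʳ : ∀ M m → 2 * (2 * suc M * m) ≡ m * (2 * suc M * 1 * 2)
    expandʳ = solve-∀
    -- Adding ½ without cancellation gives the denominator 2 D, so after clearing denominators this
    -- is twice the hypothesis.
    numerators : (+ 1 ℤ.* + k ℤ.* + 2 ℤ.+ + 1 ℤ.* + (D * 1)) ℤ.* + 1 ℤ.≤ + m ℤ.* + (D * 1 * 2)
    numerators = subst₂ ℤ._≤_ lhs (ℤ.pos-* m (D * 1 * 2)) (ℤ.+≤+ (ℕ.≤-trans (ℕ.≤-reflexive (expandˡ k M))
      (ℕ.≤-trans (ℕ.*-monoʳ-≤ 2 k+M≤) (ℕ.≤-reflexive (expandʳ M m)))))

  module _ {r : ℕ} (1≤r : 1 ≤ r) where

    -- The predecessor is used so that 2 * `suc M` is visibly nonzero, as a denominator has to be.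
    M : ℕ
    M = pred (denominator r)

    suc-M : suc M ≡ denominator r
    suc-M = ℕ.suc-pred (denominator r) {{>-nonZero (ℕ.≤-trans (ℕ.≤-trans 1≤r (ℕ.m≤m+n r (cutSize r))) (r+cut≤denominator r))}}

    ε : ℚ
    ε = + 1 / (2 * suc M)

    0<ε : 0ℚ <ℚ ε
    0<ε = ℚ.positive⁻¹ ε {{ℚ.normalize-pos 1 (2 * suc M)}}

    nonadjacent-XY-paths : (n : ℕ) (G : Graph n) → ¬ HasTopMinorK r G → (X Y : Subset n) (k : ℕ) → 1 ≤ k →
      Σ (Fin k → List (Fin n)) (DisjointXYPaths G X Y k) →
      Σ ℕ λ m → Σ (Fin m → List (Fin n)) λ P →
      NonAdjacentXYPaths G X Y m P × ((ε *ℚ (+ k / 1)) +ℚ ½) ≤ℚ (+ m / 1)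
    nonadjacent-XY-paths n G no-minor X Y k 1≤k (P , isPath , disjoint) = assemble
        (nonadjacent-system k {λ _ → ⊤} ℕ.≤-refl (λ _ → yes tt) 1≤k rows
          (λ {i} {j} {x} x∈ x∈′ → decidable-stable (i F.≟ j) (λ i≢j → disjoint i j i≢j x x∈ x∈′)))
      where
      open InGraph G
      open Induction G 1≤r no-minor (_∈ₛ? X) (_∈ₛ? Y) using (System; Result; nonadjacent-system)
      rows : System (λ _ → ⊤) k
      rows = record
        { path  = P
        ; src   = λ i → proj₁ (isPath i)
        ; dst   = λ i → proj₁ (proj₂ (isPath i))
        ; walk  = λ i → let _ , _ , _ , _ , (w , _) , h , l = isPath i
                        in  walk-map (λ _ _ e → e , tt , tt) (fromIsWalk w h l)
        ; src∈X = λ i → proj₁ (proj₂ (proj₂ (isPath i))) , tt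
        ; dst∈Y = λ i → proj₁ (proj₂ (proj₂ (proj₂ (isPath i)))) , tt
        }
      assemble : Result (λ _ → ⊤) k → Σ ℕ λ m → Σ (Fin m → List (Fin n)) λ P →
        NonAdjacentXYPaths G X Y m P × ((ε *ℚ (+ k / 1)) +ℚ ½) ≤ℚ (+ m / 1)
      assemble (m , Q , Q-disj , Q-nonadj , bound) = m , (λ i → proj₁ (short i)) ,
        (((λ i → src Q i , dst Q i , proj₁ (src∈X Q i) , proj₁ (dst∈Y Q i) , toPathFromTo (proj₁ (proj₂ (short i)))) ,
          (λ i j i≢j x x∈ x∈′ → i≢j (Q-disj (sub i x∈) (sub j x∈′)))) ,
         (λ i j i≢j x y x∈ y∈ e → i≢j (Q-nonadj (sub i x∈) (sub j y∈) (e , tt , tt)))) ,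
        rational-bound M k m (subst (λ d → k + d ≤ 2 * d * m) (≡.sym suc-M) bound)
        where
        -- The walks found may repeat vertices. Shortcuts turn them into paths on a subset of their
        -- vertices, so disjointness and non-adjacency persist.
        short : ∀ i → ∃ λ q → InducedPath (src Q i) (dst Q i) q × (∀ {y} → y ∈ q → y ∈ path Q i)
        short i = shortcut (walk-map (λ _ _ → proj₁) (walk Q i))
        sub : ∀ i {x} → x ∈ proj₁ (short i) → x ∈ path Q i
        sub i = proj₂ (proj₂ (short i))

open import Data.Integer using (+_)
open import Data.Rational using (ℚ; _/_; ½; _+_; _*_; 0ℚ) renaming (_<_ to _<ℚ_; _≤_ to _≤ℚ_)

theorem3p3 : (r : ℕ) → 1 ≤ r →
    Σ ℚ λ ε → 0ℚ <ℚ ε ×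
    ((n : ℕ) (G : Graph n) → ¬ HasTopMinorK r G →
    (X Y : Subset n) (k : ℕ) → 1 ≤ k →
    Σ (Fin k → List (Fin n)) (DisjointXYPaths G X Y k) →
    Σ ℕ λ m → Σ (Fin m → List (Fin n)) λ P →
    NonAdjacentXYPaths G X Y m P × (ε * (+ k / 1) + ½) ≤ℚ (+ m / 1))
theorem3p3 r 1≤r = InducedMenger.ε 1≤r , InducedMenger.0<ε 1≤r , InducedMenger.nonadjacent-XY-paths 1≤r
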